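{- Let $G\subset S_n$ be a transitive permutation group, $\mathrm{inv}$ a counting invariant with exponent function $\exp$, and $Q$ a global field with $\gcd(|G|,\mathrm{char}(Q))=1$. Let $d=\mathrm{lcm}\{\mathrm{ord}(g): \exp(g)=\exp(G)\}$. Then $$b_T(G^{\mathrm{inv}},Q)=\max_{\pi,\phi}\ b(\pi,\phi),$$ where the maximum is taken only over those pairs $(\pi,\phi)$ such that $\pi:G\to G/N$ is a quotient map with $\exp(\mathrm{Ker}(\pi))=\exp(G)$ and $\phi:G_Q\to G/N$ is a continuous surjection that factors through $\mathrm{Gal}(Q(\mu_d)/Q)\to G/N$.
   Context: The exponent function of a counting invariant is a function $\exp$ from the nonidentity conjugacy classes of $G$ to $\mathbb{Z}_{>0}$ such that $\exp(g)=\exp(g^k)$ whenever $\gcd(k,\mathrm{ord}(g))=1$; it records the exponent of $|v|$ in $\mathrm{inv}(K)$ when the tame inertia generator at a place $v\nmid |G|\infty$ is $g$ (the remaining local data of $\mathrm{inv}$, at places dividing $|G|\infty$, plays no role here). For the discriminant, $\exp(g)=\mathrm{ind}(g)=n-\#\{\text{cycles of } g\}$. For a nontrivial subgroup $N\subseteq G$, $\exp(N)=\min_{e\neq g\in N}\exp(g)$. Definition of $b(\pi,\phi)$. Let $N\trianglelefteq G$, $\pi:G\to G/N$ the quotient map, and $\phi:G_Q\to G/N$ a continuous surjection. Let $Q(\phi)$ be the fixed field of $\ker\phi$, $M(\phi)=Q(\phi)\cap Q(\mu_d)$, and let $$G(\pi,\phi)\subset G\times\mathrm{Gal}(Q(\mu_d)/Q)\subset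 G\times(\mathbb{Z}/d\mathbb{Z})^\times$$ be the fibre product over $\mathrm{Gal}(M(\phi)/Q)$ of $G\xrightarrow{\pi}G/N\simeq\mathrm{Gal}(Q(\phi)/Q)\to\mathrm{Gal}(M(\phi)/Q)$ and the restriction map $\mathrm{Gal}(Q(\mu_d)/Q)\to\mathrm{Gal}(M(\phi)/Q)$. It acts on $\mathcal{S}_{min}(N^{\mathrm{inv}})=\{g\in N\setminus\{e\}:\exp(g)=\exp(N)\}$ by $(x,y)\cdot g=x^{ -1}g^yx$, and $b(\pi,\phi)$ is the number of orbits. Türkelli's constant is $b_T(G^{\mathrm{inv}},Q)=\max_{\pi,\phi}b(\pi,\phi)$, where $\pi$ ranges over all quotient maps $G\to G/N$ with $\exp(N)=\exp(G)$ and $\phi$ ranges over all continuous surjections $\phi:G_Q\to G/N$ that factor through $\mathrm{Gal}(Q(\mu_\infty)/Q)$. -}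

module Defs where

open import Level using (_⊔_; suc; 0ℓ)
open import Algebra.Apartness.Bundles using (HeytingField; HeytingCommutativeRing)
open import Algebra.Bundles using (RawRing; RawMonoid; RawMagma; CommutativeRing)
open import Algebra.Morphism.Structures using (IsMagmaHomomorphism; IsRingHomomorphism; IsRingIsomorphism)
import Algebra.Definitions.RawMonoid as MonoidDefs
import Algebra.Definitions.RawSemiring as SemiringDefs
import Algebra.Morphism.Construct.Composition as Compose
open import Data.Fin.Base using (Fin)
open import Data.Fin.Permutation as Perm using (Permutation′; _⟨$⟩ʳ_; _∘ₚ_; flip)
open import Data.List.Base using (List; []; _∷_; map)
open import Data.List.Relation.Unary.All using (All)
open import Data.List.Relation.Unary.Any using (Any)
open import Data.Nat.Base as ℕ using (ℕ; zero)
open import Data.Nat.Coprimality using (Coprime)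
open import Data.Nat.Divisibility using (_∣_)
open import Data.Nat.Primality using (Prime)
open import Data.Product.Base using (∃; _×_; _,_; proj₁; proj₂)
open import Data.Sum.Base using (_⊎_; inj₁; inj₂)
open import Data.Unit.Base using (⊤; tt)
open import Function.Bundles using (_⇔_)
open import Function.Definitions using (Bijective; Surjective)
open import Relation.Binary.Core using (Rel)
open import Relation.Binary.Definitions using (_Respects_)
open import Relation.Binary.PropositionalEquality.Core using (_≡_)
open import Relation.Nullary.Negation.Core using (¬_)
open import Relation.Unary using (Pred; _∈_; _⊆_; ∅)

------------------------------------------------------------------------
-- Numbers

IsMinimum : ∀ {p} → Pred ℕ p → Pred ℕ p
IsMinimum P m = P m × (∀ k → P k → m ℕ.≤ k)

IsMaximum : ∀ {p} → Pred ℕ p → Pred ℕ p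
IsMaximum P m = P m × (∀ k → P k → k ℕ.≤ m)

IsLCM : ∀ {p} → Pred ℕ p → Pred ℕ p
IsLCM P d = (∀ m → P m → m ∣ d) × (∀ e → (∀ m → P m → m ∣ e) → d ∣ e)

-- m is the number of classes of _~_: some f : Fin m → A is a complete,
-- irredundant system of representatives.

NumberOfClasses : ∀ {a r} {A : Set a} → Rel A r → ℕ → Set (a ⊔ r)
NumberOfClasses {A = A} _~_ m = ∃ λ (f : Fin m → A) → Bijective _≡_ _~_ f

------------------------------------------------------------------------
-- Permutation groups.  Products are read from left to right:
-- x ∘ₚ y is first x, then y.

permMonoid : ℕ → RawMonoid 0ℓ 0ℓ
permMonoid n = record { Carrier = Permutation′ n ; _≈_ = Perm._≈_ ; _∙_ = _∘ₚ_ ; ε = Perm.id }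

infixr 10 _^_

_^_ : ∀ {n} → Permutation′ n → ℕ → Permutation′ n
_^_ {n} g k = MonoidDefs._×_ (permMonoid n) k g

IsOrderOf : ∀ {n} → Permutation′ n → ℕ → Set
IsOrderOf g = IsMinimum (λ k → 0 ℕ.< k × g ^ k Perm.≈ Perm.id)

module _ {n : ℕ} where

  record IsPermutationGroup (G : Pred (Permutation′ n) 0ℓ) : Set where
    field
      resp      : G Respects Perm._≈_
      id∈       : Perm.id ∈ G
      ∘-closed  : ∀ {x y} → x ∈ G → y ∈ G → x ∘ₚ y ∈ G
      ⁻¹-closed : ∀ {x} → x ∈ G → flip x ∈ G

  IsTransitive : Pred (Permutation′ n) 0ℓ → Set
  IsTransitive G = ∀ i j → ∃ λ g → g ∈ G × g ⟨$⟩ʳ i ≡ j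

  record IsNormalSubgroup (N G : Pred (Permutation′ n) 0ℓ) : Set where
    field
      isPermutationGroup : IsPermutationGroup N
      N⊆G                : N ⊆ G
      conj-closed        : ∀ {x g} → x ∈ G → g ∈ N → flip x ∘ₚ g ∘ₚ x ∈ N

  Elt : Pred (Permutation′ n) 0ℓ → Set
  Elt G = ∃ (_∈ G)

  GroupOrder : Pred (Permutation′ n) 0ℓ → ℕ → Set
  GroupOrder G = NumberOfClasses {A = Elt G} (λ x y → proj₁ x Perm.≈ proj₁ y)

  -- G/N is G with the equality x N = y N.

  quotient : ∀ {G} → IsPermutationGroup G → Pred (Permutation′ n) 0ℓ → RawMagma 0ℓ 0ℓ
  quotient {G} isGroup N = record
    { Carrier = Elt G
    ; _≈_     = λ x y → flip (proj₁ x) ∘ₚ proj₁ y ∈ N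
    ; _∙_     = λ x y → proj₁ x ∘ₚ proj₁ y , IsPermutationGroup.∘-closed isGroup (proj₂ x) (proj₂ y)
    }

  record NonIdentity (G : Pred (Permutation′ n) 0ℓ) : Set where
    field
      elem : Permutation′ n
      mem  : elem ∈ G
      ≉id  : ¬ elem Perm.≈ Perm.id

  open NonIdentity public

  -- A function on the nonidentity conjugacy classes is a class function;
  -- the case x = id of exp-conj says that exp respects equality.

  record ExponentFunction (G : Pred (Permutation′ n) 0ℓ) : Set where
    field
      exp       : NonIdentity G → ℕ
      exp-pos   : ∀ g → 0 ℕ.< exp g
      exp-conj  : ∀ g h {x} → x ∈ G → elem h Perm.≈ flip x ∘ₚ elem g ∘ₚ x → exp g ≡ exp h
      exp-power : ∀ g h {k m} → IsOrderOf (elem g) m → Coprime k m →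
                  elem h Perm.≈ elem g ^ k → exp g ≡ exp h

  module _ {G : Pred (Permutation′ n) 0ℓ} (inv : ExponentFunction G) where
    open ExponentFunction inv

    -- exp(N) = v; there is no such v when N is trivial.

    IsExpOf : Pred (Permutation′ n) 0ℓ → ℕ → Set
    IsExpOf N = IsMinimum (λ v → ∃ λ (g : NonIdentity G) → elem g ∈ N × exp g ≡ v)

    MinimalOrder : Pred ℕ 0ℓ
    MinimalOrder m = ∃ λ (g : NonIdentity G) → IsExpOf G (exp g) × IsOrderOf (elem g) m

    S-min : Pred (Permutation′ n) 0ℓ → Set
    S-min N = ∃ λ (g : NonIdentity G) → elem g ∈ N × IsExpOf N (exp g)

------------------------------------------------------------------------
-- Fields.  In the presence of excluded middle a Heyting field is the
-- same thing as a field: x # y means x ≉ y.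

module FieldTheory {c ℓ₁ ℓ₂} (K : HeytingField c ℓ₁ ℓ₂) where
  open HeytingField K

  commutativeRing : CommutativeRing c ℓ₁
  commutativeRing = HeytingCommutativeRing.commutativeRing heytingCommutativeRing

  open CommutativeRing commutativeRing public using (rawRing)
  open SemiringDefs (RawRing.rawSemiring rawRing) public using (sum) renaming (_×_ to _·_; _^_ to _↑_)

  -- Characteristic 0 is the case p = 0.

  HasCharacteristic : ℕ → Set ℓ₁
  HasCharacteristic p = ∀ n → (n · 1# ≈ 0#) ⇔ (p ∣ n)

  -- The subfield generated by S; the prime subfield is Generated ∅.

  data Generated {p} (S : Pred Carrier p) : Pred Carrier (c ⊔ ℓ₁ ⊔ p) where
    gen  : ∀ {x} → x ∈ S → x ∈ Generated S
    resp : ∀ {x y} → x ≈ y → x ∈ Generated S → y ∈ Generated S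
    one  : 1# ∈ Generated S
    add  : ∀ {x y} → x ∈ Generated S → y ∈ Generated S → x + y ∈ Generated S
    neg  : ∀ {x} → x ∈ Generated S → - x ∈ Generated S
    mul  : ∀ {x y} → x ∈ Generated S → y ∈ Generated S → x * y ∈ Generated S
    inv  : ∀ {x y} → x ∈ Generated S → x * y ≈ 1# → y ∈ Generated S

  IsFiniteOver : ∀ {p} → Pred Carrier p → Set (c ⊔ ℓ₁ ⊔ p)
  IsFiniteOver F = ∃ λ m → ∃ λ (e : Fin m → Carrier) → ∀ x →
    ∃ λ (a : Fin m → Carrier) → (∀ i → a i ∈ F) × x ≈ sum (λ i → a i * e i)

  -- Polynomials are lists of coefficients, constant coefficient first.

  Poly : Set c
  Poly = List Carrier

  coeff : Poly → ℕ → Carrier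
  coeff []      _         = 0#
  coeff (a ∷ f) zero      = a
  coeff (a ∷ f) (ℕ.suc k) = coeff f k

  eval : Poly → Carrier → Carrier
  eval []      x = 0#
  eval (a ∷ f) x = a + x * eval f x

  infixl 6 _+ᵖ_
  infixl 7 _*ᵖ_

  _+ᵖ_ : Poly → Poly → Poly
  []      +ᵖ g       = g
  (a ∷ f) +ᵖ []      = a ∷ f
  (a ∷ f) +ᵖ (b ∷ g) = a + b ∷ f +ᵖ g

  _*ᵖ_ : Poly → Poly → Poly
  []      *ᵖ g = []
  (a ∷ f) *ᵖ g = map (a *_) g +ᵖ (0# ∷ f *ᵖ g)

  -- (a + X f)′ = f + X f′

  derivative : Poly → Poly
  derivative []      = []
  derivative (a ∷ f) = f +ᵖ (0# ∷ derivative f)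

  IsNonzero : Poly → Set (c ⊔ ℓ₁)
  IsNonzero = Any (λ a → ¬ a ≈ 0#)

  -- gcd(f , f′) = 1 in Bézout form

  IsSeparable : Poly → Set (c ⊔ ℓ₁)
  IsSeparable f = ∃ λ u → ∃ λ v → ∀ k →
    coeff (u *ᵖ f +ᵖ v *ᵖ derivative f) k ≈ coeff (1# ∷ []) k

  IsSeparablyClosed : Set (c ⊔ ℓ₁)
  IsSeparablyClosed = ∀ a f → IsNonzero f → IsSeparable (a ∷ f) → ∃ λ x → eval (a ∷ f) x ≈ 0#

  IsTranscendentalOver : ∀ {p} → Pred Carrier p → Carrier → Set (c ⊔ ℓ₁ ⊔ p)
  IsTranscendentalOver F t = ∀ f → All F f → eval f t ≈ 0# → All (_≈ 0#) f

  -- A finite extension of ℚ, or of some 𝔽_p(t).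

  IsGlobalField : Set (c ⊔ ℓ₁)
  IsGlobalField =
    (HasCharacteristic 0 × IsFiniteOver (Generated ∅))
    ⊎ (∃ λ p → Prime p × HasCharacteristic p ×
        ∃ λ t → IsTranscendentalOver (Generated ∅) t × IsFiniteOver (Generated (_≈ t)))

open FieldTheory public
  using (HasCharacteristic; IsGlobalField; IsSeparablyClosed)

------------------------------------------------------------------------
-- Galois groups of the intermediate fields of an extension Ω/Q

module Galois
  {c ℓ₁ ℓ₂ c′ ℓ₁′ ℓ₂′} {Q : HeytingField c ℓ₁ ℓ₂} {Ω : HeytingField c′ ℓ₁′ ℓ₂′}
  {ι : HeytingField.Carrier Q → HeytingField.Carrier Ω}
  (isHom : IsRingHomomorphism (FieldTheory.rawRing Q) (FieldTheory.rawRing Ω) ι)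
  where

  private
    module Q  = HeytingField Q
    module FQ = FieldTheory Q
    module FΩ = FieldTheory Ω
    module ι  = IsRingHomomorphism isHom
  open HeytingField Ω
  open FΩ using (_↑_)

  record IntermediateField p : Set (c ⊔ c′ ⊔ ℓ₁′ ⊔ suc p) where
    field
      Member     : Pred Carrier p
      resp       : Member Respects _≈_
      base       : ∀ q → ι q ∈ Member
      +-closed   : ∀ {x y} → x ∈ Member → y ∈ Member → x + y ∈ Member
      *-closed   : ∀ {x y} → x ∈ Member → y ∈ Member → x * y ∈ Member
      neg-closed : ∀ {x} → x ∈ Member → - x ∈ Member
      inv-closed : ∀ {x y} → x ∈ Member → x * y ≈ 1# → y ∈ Member

    Element : Set (c′ ⊔ p)
    Element = ∃ Member

    rawRing : RawRing (c′ ⊔ p) ℓ₁′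
    rawRing = record
      { Carrier = Element
      ; _≈_     = λ x y → proj₁ x ≈ proj₁ y
      ; _+_     = λ x y → proj₁ x + proj₁ y , +-closed (proj₂ x) (proj₂ y)
      ; _*_     = λ x y → proj₁ x * proj₁ y , *-closed (proj₂ x) (proj₂ y)
      ; -_      = λ x → - proj₁ x , neg-closed (proj₂ x)
      ; 0#      = 0# , resp ι.0#-homo (base Q.0#)
      ; 1#      = 1# , resp ι.1#-homo (base Q.1#)
      }

  open IntermediateField using (Member; Element)

  wholeField : IntermediateField 0ℓ
  wholeField = record
    { Member = λ _ → ⊤ ; resp = λ _ _ → tt ; base = λ _ → tt ; +-closed = λ _ _ → tt
    ; *-closed = λ _ _ → tt ; neg-closed = λ _ → tt ; inv-closed = λ _ _ → tt }

  intersection : ∀ {p q} → IntermediateField p → IntermediateField q → IntermediateField (p ⊔ q)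
  intersection E F = record
    { Member     = λ x → x ∈ Member E × x ∈ Member F
    ; resp       = λ eq (x , y) → E.resp eq x , F.resp eq y
    ; base       = λ q → E.base q , F.base q
    ; +-closed   = λ (x , x′) (y , y′) → E.+-closed x y , F.+-closed x′ y′
    ; *-closed   = λ (x , x′) (y , y′) → E.*-closed x y , F.*-closed x′ y′
    ; neg-closed = λ (x , x′) → E.neg-closed x , F.neg-closed x′
    ; inv-closed = λ (x , x′) eq → E.inv-closed x eq , F.inv-closed x′ eq
    }
    where
    module E = IntermediateField E
    module F = IntermediateField F

  adjoin : ∀ {p} → Pred Carrier p → IntermediateField (c ⊔ c′ ⊔ ℓ₁′ ⊔ p)
  adjoin S = record
    { Member     = FΩ.Generated (λ x → (∃ λ q → x ≈ ι q) ⊎ x ∈ S)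
    ; resp       = FΩ.resp
    ; base       = λ q → FΩ.gen (inj₁ (q , refl))
    ; +-closed   = FΩ.add
    ; *-closed   = FΩ.mul
    ; neg-closed = FΩ.neg
    ; inv-closed = FΩ.inv
    }

  μ : ℕ → Pred Carrier ℓ₁′
  μ d z = z ↑ d ≈ 1#

  μ∞ : Pred Carrier ℓ₁′
  μ∞ z = ∃ λ d → 0 ℕ.< d × z ∈ μ d

  Q⟨μ_⟩ : ℕ → IntermediateField (c ⊔ c′ ⊔ ℓ₁′)
  Q⟨μ d ⟩ = adjoin (μ d)

  Q⟨μ∞⟩ : IntermediateField (c ⊔ c′ ⊔ ℓ₁′)
  Q⟨μ∞⟩ = adjoin μ∞

  record Automorphism {p} (E : IntermediateField p) : Set (c ⊔ c′ ⊔ ℓ₁′ ⊔ p) where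
    private module E = IntermediateField E
    field
      to                : Element E → Element E
      isRingIsomorphism : IsRingIsomorphism E.rawRing E.rawRing to
      fixes-base        : ∀ q → proj₁ (to (ι q , E.base q)) ≈ ι q

    open IsRingIsomorphism isRingIsomorphism public

  open Automorphism using (to)

  compose : ∀ {p} {E : IntermediateField p} → Automorphism E → Automorphism E → Automorphism E
  compose σ τ = record
    { to                = λ x → to σ (to τ x)
    ; isRingIsomorphism = Compose.isRingIsomorphism trans
                            (Automorphism.isRingIsomorphism τ) (Automorphism.isRingIsomorphism σ)
    ; fixes-base        = λ q → trans (Automorphism.⟦⟧-cong σ (Automorphism.fixes-base τ q))
                                      (Automorphism.fixes-base σ q)
    }

  -- Gal(E/Q).  Between groups, a homomorphism is a map of magmas.

  Gal : ∀ {p} → IntermediateField p → RawMagma (c ⊔ c′ ⊔ ℓ₁′ ⊔ p) (c′ ⊔ ℓ₁′ ⊔ p)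
  Gal E = record
    { Carrier = Automorphism E
    ; _≈_     = λ σ τ → ∀ x → proj₁ (to σ x) ≈ proj₁ (to τ x)
    ; _∙_     = compose
    }

  G[Q] : Set (c ⊔ c′ ⊔ ℓ₁′)
  G[Q] = Automorphism wholeField

  infixr 8 _⟪_⟫

  _⟪_⟫ : G[Q] → Carrier → Carrier
  σ ⟪ a ⟫ = proj₁ (to σ (a , tt))

  _IsRestrictionOf_ : ∀ {p} {E : IntermediateField p} → Automorphism E → G[Q] → Set (c′ ⊔ ℓ₁′ ⊔ p)
  _IsRestrictionOf_ {E = E} τ σ = ∀ (x : Element E) → proj₁ (to τ x) ≈ σ ⟪ proj₁ x ⟫

  -- Ω/Q is an algebraic extension, Q is the fixed field of its group of
  -- automorphisms (which makes it a Galois extension), and it is maximal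
  -- among such extensions: it is a separable closure of Q.

  record IsSeparableClosure : Set (c ⊔ c′ ⊔ ℓ₁ ⊔ ℓ₁′) where
    field
      algebraic       : ∀ a → ∃ λ f → FQ.IsNonzero f × FΩ.eval (map ι f) a ≈ 0#
      fixedField      : ∀ a → (∀ (σ : G[Q]) → σ ⟪ a ⟫ ≈ a) → ∃ λ q → a ≈ ι q
      separablyClosed : IsSeparablyClosed Ω

  fixedFieldOf : ∀ {p} → Pred G[Q] p → IntermediateField (c ⊔ c′ ⊔ ℓ₁′ ⊔ p)
  fixedFieldOf H = record
    { Member     = λ a → ∀ σ → σ ∈ H → σ ⟪ a ⟫ ≈ a
    ; resp       = λ eq fix σ σ∈H → trans (cong′ σ (sym eq)) (trans (fix σ σ∈H) eq)
    ; base       = λ q σ _ → Automorphism.fixes-base σ q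
    ; +-closed   = λ x y σ h → trans (Automorphism.+-homo σ _ _) (+-cong (x σ h) (y σ h))
    ; *-closed   = λ x y σ h → trans (Automorphism.*-homo σ _ _) (*-cong (x σ h) (y σ h))
    ; neg-closed = λ x σ h → trans (Automorphism.-‿homo σ _) (-‿cong (x σ h))
    ; inv-closed = λ x eq σ h → inverse-unique eq
        (trans (*-cong (sym (x σ h)) refl)
          (trans (sym (Automorphism.*-homo σ _ _))
            (trans (cong′ σ eq) (Automorphism.1#-homo σ))))
    }
    where
    cong′ : ∀ (σ : G[Q]) {a b} → a ≈ b → σ ⟪ a ⟫ ≈ σ ⟪ b ⟫
    cong′ σ = Automorphism.⟦⟧-cong σ

    inverse-unique : ∀ {x y z} → x * y ≈ 1# → x * z ≈ 1# → z ≈ y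
    inverse-unique {x} {y} {z} xy xz =
      trans (sym (*-identityˡ z)) (trans (*-cong (sym (trans (*-comm y x) xy)) refl)
        (trans (*-assoc y x z) (trans (*-cong refl xz) (*-identityʳ y))))

  ----------------------------------------------------------------------
  -- The constants b(π , φ), where π : G → G/N is given by N

  module _ {n : ℕ} {G : Pred (Permutation′ n) 0ℓ} (isGroup : IsPermutationGroup G) where

    record ContinuousSurjection (N : Pred (Permutation′ n) 0ℓ) : Set (c ⊔ c′ ⊔ ℓ₁′) where
      private
        module G/N = RawMagma (quotient isGroup N)
        module G_Q = RawMagma (Gal wholeField)
      field
        ⟦_⟧            : G[Q] → Elt G
        isHomomorphism : IsMagmaHomomorphism (Gal wholeField) (quotient isGroup N) ⟦_⟧
        surjective     : Surjective G_Q._≈_ G/N._≈_ ⟦_⟧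
        -- G/N is discrete; the automorphisms that agree with σ on a
        -- finite set are the basic neighbourhoods of σ.
        continuous     : ∀ σ → ∃ λ (S : List Carrier) → ∀ τ →
                         All (λ a → τ ⟪ a ⟫ ≈ σ ⟪ a ⟫) S → ⟦ τ ⟧ G/N.≈ ⟦ σ ⟧

    module _ {N : Pred (Permutation′ n) 0ℓ} (φ : ContinuousSurjection N) where
      open ContinuousSurjection φ
      private module G/N = RawMagma (quotient isGroup N)

      FactorsThrough : ∀ {p} → IntermediateField p → Set (c ⊔ c′ ⊔ ℓ₁′ ⊔ p)
      FactorsThrough E = ∃ λ (ψ : Automorphism E → Elt G) →
        IsMagmaHomomorphism (Gal E) (quotient isGroup N) ψ ×
        (∀ σ → ∃ λ τ → τ IsRestrictionOf σ × ⟦ σ ⟧ G/N.≈ ψ τ)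

      Q⟨φ⟩ : IntermediateField (c ⊔ c′ ⊔ ℓ₁′)
      Q⟨φ⟩ = fixedFieldOf (λ σ → proj₁ ⟦ σ ⟧ ∈ N)

      M⟨φ⟩ : ℕ → IntermediateField (c ⊔ c′ ⊔ ℓ₁′)
      M⟨φ⟩ d = intersection Q⟨φ⟩ Q⟨μ d ⟩

      -- α corresponds to π(x) under G/N ≃ Gal(Q(φ)/Q), the isomorphism
      -- induced by φ.

      Corresponds : Elt G → Automorphism Q⟨φ⟩ → Set (c ⊔ c′ ⊔ ℓ₁′)
      Corresponds x α = ∃ λ σ → ⟦ σ ⟧ G/N.≈ x × α IsRestrictionOf σ

      -- The pairs (x , k mod d) in G(π , φ), where y ∈ Gal(Q(μ_d)/Q) is
      -- identified with the k mod d such that y(ζ) = ζᵏ on μ_d.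

      FibreProduct : ℕ → Elt G → ℕ → Set (c ⊔ c′ ⊔ ℓ₁′)
      FibreProduct d x k = Coprime k d ×
        ∃ λ (α : Automorphism Q⟨φ⟩) → ∃ λ (y : Automorphism Q⟨μ d ⟩) →
          Corresponds x α ×
          (∀ (ζ : Element Q⟨μ d ⟩) → proj₁ ζ ∈ μ d → proj₁ (to y ζ) ≈ proj₁ ζ ↑ k) ×
          (∀ ((a , p , q) : Element (M⟨φ⟩ d)) → proj₁ (to α (a , p)) ≈ proj₁ (to y (a , q)))

      module _ (inv : ExponentFunction G) (d : ℕ) where

        -- g and h lie in the same orbit: h = x⁻¹ gᵏ x with (x , k) in
        -- G(π , φ).  As ord(g) divides d, gᵏ only depends on k mod d.

        SameOrbit : Rel (S-min inv N) (c ⊔ c′ ⊔ ℓ₁′)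
        SameOrbit (g , _) (h , _) = ∃ λ x → ∃ λ k → FibreProduct d x k ×
          elem h Perm.≈ flip (proj₁ x) ∘ₚ (elem g ^ k) ∘ₚ proj₁ x

        IsB : ℕ → Set (c ⊔ c′ ⊔ ℓ₁′)
        IsB = NumberOfClasses SameOrbit

    module _ (inv : ExponentFunction G) (d : ℕ) where

      -- The values b(π , φ), where exp(Ker π) = exp(G) and φ factors
      -- through Gal(E/Q).

      BValue : ∀ {p} → IntermediateField p → Pred ℕ (suc 0ℓ ⊔ c ⊔ c′ ⊔ ℓ₁′ ⊔ p)
      BValue E b = ∃ λ (N : Pred (Permutation′ n) 0ℓ) → IsNormalSubgroup N G ×
        (∃ λ v → IsExpOf inv N v × IsExpOf inv G v) ×
        ∃ λ (φ : ContinuousSurjection N) → FactorsThrough φ E × IsB φ inv d b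

      IsTürkelliConstant : Pred ℕ (suc 0ℓ ⊔ c ⊔ c′ ⊔ ℓ₁′)
      IsTürkelliConstant = IsMaximum (BValue Q⟨μ∞⟩)

{-# OPTIONS --safe #-}

-- Given N and φ, let M = M(φ) = Q(φ) ∩ Q(μ_d), let N′ ⊇ N be the preimage in G of
-- Gal(Q(φ)/M), and let φ′ be the composite G_Q → G/N → G/N′.  Then φ′ factors through
-- Gal(Q(μ_d)/Q), as M ⊆ Q(μ_d), and G(π′, φ′) ⊆ G(π, φ), so elements of S_min(N) in
-- different orbits stay in different orbits of S_min(N′) and b(π′, φ′) ≥ b(π, φ).
-- Hence the two maxima agree; they exist as every b is at most |G|.
--
-- That φ′ is defined on all of Gal(Q(μ_d)/Q) requires every automorphism y of Q(μ_d)
-- to agree on M with an element of G_Q, which follows from the independence of characters of M.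

module Submission where

open import Defs
open import Algebra.Apartness.Bundles using (HeytingField)
import Algebra.Apartness.Properties.HeytingCommutativeRing as HeytingProperties
open import Algebra.Bundles using (CommutativeRing; Group; Monoid)
open import Algebra.Morphism.Structures using (IsMagmaHomomorphism; IsRingHomomorphism)
import Algebra.Properties.CommutativeMonoid.Sum as Sum
import Algebra.Properties.Group as GroupProperties
import Algebra.Properties.Monoid.Mult as Mult
import Algebra.Properties.Ring as RingProperties
import Algebra.Properties.Semiring.Sum as SemiringSum
open import Axiom.ExcludedMiddle using (ExcludedMiddle)
open import Data.Fin.Base using (Fin; zero; suc; toℕ; splitAt; punchIn)
open import Data.Fin.Permutation as Perm using (Permutation′; permutation; _⟨$⟩ʳ_; _⟨$⟩ˡ_; _∘ₚ_; flip)
open import Data.Fin.Properties as Fin using (injective⇒≤; pigeonhole)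
open import Data.List.Base using ([])
open import Data.Nat.Base as ℕ using (ℕ; zero; suc; _≤_; _<_; _!; z≤n)
open import Data.Nat.Coprimality as Coprimality using (Coprime; coprime-Bézout)
open import Data.Nat.Divisibility as ∣ using (_∣_; divides)
open import Data.Nat.GCD using (gcd; module Bézout)
open import Data.Nat.Induction using (<-rec)
open import Data.Nat.Primality using (Prime)
import Data.Nat.Properties as ℕ
open import Data.Nat.Solver using (module +-*-Solver)
open import Data.Product.Base using (∃; ∃₂; _×_; _,_; proj₁; proj₂)
open import Data.Sum.Base using (inj₁; inj₂; [_,_]′)
open import Data.Sum.Properties using ([,]-map)
open import Data.Unit.Base using (tt)
open import Function.Base using (_∘_; const)
open import Function.Definitions using (Injective)
open import Level using (0ℓ; _⊔_)
open import Relation.Binary.Core using (Rel)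
open import Relation.Binary.Definitions using (Symmetric)
open import Relation.Binary.PropositionalEquality as ≡ using (_≡_)
open import Relation.Nullary.Decidable.Core using (Dec; yes; no; True; toWitness; fromWitness; decidable-stable)
open import Relation.Nullary.Negation.Core using (¬_; contradiction)
open import Relation.Unary using (Pred; _∈_; _⊆_)

-- Counting and modular inverses

-- The fibre product sees φ only through the composite G → Gal(M/Q), which φ′ retains. Enlarging the
-- kernel can therefore add elements to S_min but cannot merge orbits.
--
-- The obstacle is that a factorisation through Gal(E/Q) must be defined on every automorphism of E,
-- including those not known to come from G_Q. Extending them to Ω would call for Zorn's lemma.
-- Agreement on M suffices instead, because φ′(σ) depends only on the restriction of σ to M. There
-- are finitely many such restrictions, since φ(σ) determines them, so a finite trace is available.

module _ (em : ∀ {ℓ} → ExcludedMiddle ℓ) where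

  minimum : ∀ {p} {P : Pred ℕ p} k → P k → ∃ λ m → m ≤ k × IsMinimum P m
  minimum {P = P} = <-rec _ λ k rec Pk → case k rec Pk em
    where
    case : ∀ k → (∀ {j} → j < k → P j → ∃ λ m → m ≤ j × IsMinimum P m) → P k →
           Dec (∃ λ j → j < k × P j) → ∃ λ m → m ≤ k × IsMinimum P m
    case k rec Pk (yes (j , j<k , Pj)) with m , m≤j , min ← rec j<k Pj =
      m , ℕ.≤-trans m≤j (ℕ.<⇒≤ j<k) , min
    case k rec Pk (no ¬smaller) =
      k , ℕ.≤-refl , Pk , λ j Pj → ℕ.≮⇒≥ λ j<k → ¬smaller (j , j<k , Pj)

  maximum : ∀ {p} {P : Pred ℕ p} {k} → P k → ∀ bound → (∀ j → P j → j ≤ bound) → ∃ (IsMaximum P)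
  maximum {k = k} Pk zero bounded =
    k , Pk , λ j Pj → ℕ.≤-trans (bounded j Pj) z≤n
  maximum {P = P} Pk (suc bound) bounded with em {P = P (suc bound)}
  ... | yes P-bound = suc bound , P-bound , bounded
  ... | no ¬P-bound = maximum Pk bound λ j Pj →
    ℕ.≤-pred (ℕ.≤∧≢⇒< (bounded j Pj) λ { ≡.refl → ¬P-bound Pj })

  module _ {a r} {A : Set a} {_~_ : Rel A r} (~-sym : Symmetric _~_)
           {m} (index : A → Fin m) (index-reflects : ∀ {x y} → index x ≡ index y → x ~ y) where

    -- A largest irredundant family is also complete.

    countClasses : ∃ λ k → NumberOfClasses _~_ k ×
      (∀ {j} (f : Fin j → A) → Injective _≡_ _~_ f → j ≤ k)
    countClasses = extract (maximum {P = Irredundant} {k = 0} ((λ ()) , λ { {()} }) m bounded)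
      where
      Irredundant : Pred ℕ _
      Irredundant j = ∃ λ (f : Fin j → A) → Injective _≡_ _~_ f

      bounded : ∀ j → Irredundant j → j ≤ m
      bounded j (f , f-injective) = injective⇒≤ (f-injective ∘ index-reflects)

      extract : ∃ (IsMaximum Irredundant) → ∃ λ k → NumberOfClasses _~_ k ×
        (∀ {j} (f : Fin j → A) → Injective _≡_ _~_ f → j ≤ k)
      extract (k , (f , f-injective) , max) =
        k , (f , (λ {x} {y} → f-injective {x} {y}) , λ y → represent y em) ,
        λ {j} g g-injective → max j (g , λ {x} {y} → g-injective {x} {y})
        where
        represent : ∀ y → Dec (∃ λ i → f i ~ y) → ∃ λ i → ∀ {j} → j ≡ i → f j ~ y
        represent y (yes (i , fi~y)) = i , λ { ≡.refl → fi~y }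
        represent y (no ¬represented) = contradiction (max (suc k) (f⁺ , f⁺-injective)) ℕ.1+n≰n
          where
          f⁺ : Fin (suc k) → A
          f⁺ zero    = y
          f⁺ (suc i) = f i

          f⁺-injective : Injective _≡_ _~_ f⁺
          f⁺-injective {zero}  {zero}  _  = ≡.refl
          f⁺-injective {zero}  {suc j} eq = contradiction (j , ~-sym eq) ¬represented
          f⁺-injective {suc i} {zero}  eq = contradiction (i , eq) ¬represented
          f⁺-injective {suc i} {suc j} eq = ≡.cong suc (f-injective eq)

-- The congruence k k′ ≡ 1 mod d is written without subtraction.

coprime-inverse : ∀ {k d} → Coprime k d →
  ∃ λ k′ → Coprime k′ d × ∃₂ λ s t → k ℕ.* k′ ℕ.+ s ℕ.* d ≡ 1 ℕ.+ t ℕ.* d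
coprime-inverse {k} {d} k⊥d = result (coprime-Bézout k⊥d)
  where
  open +-*-Solver

  coprime : ∀ k′ s t → k ℕ.* k′ ℕ.+ s ℕ.* d ≡ 1 ℕ.+ t ℕ.* d → Coprime k′ d
  coprime k′ s t eq {i} (i∣k′ , i∣d) = ∣.∣1⇒≡1 (∣.∣m+n∣m⇒∣n
    (≡.subst (i ∣_) (≡.trans eq (ℕ.+-comm 1 _))
      (∣.∣m∣n⇒∣m+n (∣.∣n⇒∣m*n k i∣k′) (∣.∣n⇒∣m*n s i∣d)))
    (∣.∣n⇒∣m*n t i∣d))

  package : ∀ k′ s t → k ℕ.* k′ ℕ.+ s ℕ.* d ≡ 1 ℕ.+ t ℕ.* d →
            ∃ λ k′ → Coprime k′ d × ∃₂ λ s t → k ℕ.* k′ ℕ.+ s ℕ.* d ≡ 1 ℕ.+ t ℕ.* d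
  package k′ s t eq = k′ , coprime k′ s t eq , s , t , eq

  result : Bézout.Identity 1 k d →
           ∃ λ k′ → Coprime k′ d × ∃₂ λ s t → k ℕ.* k′ ℕ.+ s ℕ.* d ≡ 1 ℕ.+ t ℕ.* d
  result (Bézout.+- x y eq) = package x 0 y
    (≡.trans (ℕ.+-identityʳ _) (≡.trans (ℕ.*-comm k x) (≡.sym eq)))
  -- If u = x k ≡ −1 mod d then u² ≡ 1, in the form u² + 2 (1 + u) = 1 + (1 + u)².
  result (Bézout.-+ x y eq) = package (x ℕ.* (x ℕ.* k)) (2 ℕ.* y) (y ℕ.* (y ℕ.* d)) (begin
    k ℕ.* (x ℕ.* (x ℕ.* k)) ℕ.+ 2 ℕ.* y ℕ.* d
      ≡⟨ solve 4 (λ k x y d → k :* (x :* (x :* k)) :+ con 2 :* y :* d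
                           := (x :* k) :* (x :* k) :+ con 2 :* (y :* d)) ≡.refl k x y d ⟩
    u ℕ.* u ℕ.+ 2 ℕ.* (y ℕ.* d)
      ≡⟨ ≡.cong (λ w → u ℕ.* u ℕ.+ 2 ℕ.* w) eq ⟨
    u ℕ.* u ℕ.+ 2 ℕ.* (1 ℕ.+ u)
      ≡⟨ solve 1 (λ u → u :* u :+ con 2 :* (con 1 :+ u)
                     := con 1 :+ (con 1 :+ u) :* (con 1 :+ u)) ≡.refl u ⟩
    1 ℕ.+ (1 ℕ.+ u) ℕ.* (1 ℕ.+ u)
      ≡⟨ ≡.cong (λ w → 1 ℕ.+ w ℕ.* w) eq ⟩
    1 ℕ.+ (y ℕ.* d) ℕ.* (y ℕ.* d)
      ≡⟨ solve 2 (λ y d → con 1 :+ (y :* d) :* (y :* d)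
                       := con 1 :+ y :* (y :* d) :* d) ≡.refl y d ⟩
    1 ℕ.+ y ℕ.* (y ℕ.* d) ℕ.* d ∎)
    where
    open ≡.≡-Reasoning
    u = x ℕ.* k

module _ {c ℓ} (M : Monoid c ℓ) where
  open Monoid M
  open Mult M using () renaming (_×_ to _·_; ×-homo-+ to ·-homo-+; ×-assocˡ to ·-assocˡ;
                                 ×-congʳ to ·-congʳ; ×-congˡ to ·-congˡ)
  open import Relation.Binary.Reasoning.Setoid setoid

  ·-multiple : ∀ {x d} → d · x ≈ ε → ∀ s → (s ℕ.* d) · x ≈ ε
  ·-multiple {x} {d} dx≈ε s = begin
    (s ℕ.* d) · x  ≈⟨ ·-assocˡ x s d ⟨
    s · (d · x)    ≈⟨ ·-congʳ s dx≈ε ⟩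
    s · ε          ≈⟨ ·-ε s ⟩
    ε              ∎
    where
    ·-ε : ∀ s → s · ε ≈ ε
    ·-ε zero    = refl
    ·-ε (suc s) = trans (identityˡ _) (·-ε s)

  -- Multiples of d annihilate x, so they can be added on either side. The setting is a monoid
  -- because there are two uses: undoing g ↦ gᵏ on permutations and ζ ↦ ζᵏ on roots of unity.
  ·-modular-inverse : ∀ {x d} → d · x ≈ ε → ∀ k k′ s t →
    k ℕ.* k′ ℕ.+ s ℕ.* d ≡ 1 ℕ.+ t ℕ.* d → k′ · (k · x) ≈ x
  ·-modular-inverse {x} {d} dx≈ε k k′ s t eq = begin
    k′ · (k · x)                      ≈⟨ ·-assocˡ x k′ k ⟩
    (k′ ℕ.* k) · x                    ≈⟨ ·-congˡ (ℕ.*-comm k′ k) ⟩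
    (k ℕ.* k′) · x                    ≈⟨ identityʳ _ ⟨
    (k ℕ.* k′) · x ∙ ε                ≈⟨ ∙-congˡ (·-multiple dx≈ε s) ⟨
    (k ℕ.* k′) · x ∙ (s ℕ.* d) · x    ≈⟨ ·-homo-+ x (k ℕ.* k′) (s ℕ.* d) ⟨
    (k ℕ.* k′ ℕ.+ s ℕ.* d) · x        ≈⟨ ·-congˡ eq ⟩
    x ∙ (t ℕ.* d) · x                 ≈⟨ ∙-congˡ (·-multiple dx≈ε t) ⟩
    x ∙ ε                             ≈⟨ identityʳ x ⟩
    x                                 ∎

-- Permutations, orders of elements, and the quotient G/N

module _ {n : ℕ} where

  permutationMonoid : Monoid 0ℓ 0ℓ
  permutationMonoid = record
    { Carrier  = Permutation′ n
    ; _≈_      = Perm._≈_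
    ; _∙_      = _∘ₚ_
    ; ε        = Perm.id
    ; isMonoid = record
      { isSemigroup = record
        { isMagma = record
          { isEquivalence = record
            { refl  = λ _ → ≡.refl
            ; sym   = λ eq i → ≡.sym (eq i)
            ; trans = λ eq eq′ i → ≡.trans (eq i) (eq′ i)
            }
          ; ∙-cong = λ {_} {x′} {y} eq eq′ i → ≡.trans (≡.cong (y ⟨$⟩ʳ_) (eq i)) (eq′ (x′ ⟨$⟩ʳ i))
          }
        ; assoc = λ _ _ _ _ → ≡.refl
        }
      ; identity = (λ _ _ → ≡.refl) , (λ _ _ → ≡.refl)
      }
    }

  open Monoid permutationMonoid using (_≈_)
  open Mult permutationMonoid using (×-homo-+; ×-congʳ)

  conj-^ : ∀ (x g : Permutation′ n) k → (flip x ∘ₚ g ∘ₚ x) ^ k ≈ flip x ∘ₚ (g ^ k) ∘ₚ x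
  conj-^ x g zero    i = ≡.sym (Perm.inverseʳ x)
  conj-^ x g (suc k) i = ≡.trans (conj-^ x g k _)
    (≡.cong (λ j → x ⟨$⟩ʳ ((g ^ k) ⟨$⟩ʳ j)) (Perm.inverseˡ x))

  ^-cancel : ∀ (g : Permutation′ n) j k → g ^ (j ℕ.+ k) ≈ g ^ j → g ^ k ≈ Perm.id
  ^-cancel g j k eq i = ≡.trans (≡.cong ((g ^ k) ⟨$⟩ʳ_) (≡.sym (Perm.inverseʳ (g ^ j))))
    (≡.trans (≡.sym (×-homo-+ g j k _)) (≡.trans (eq _) (Perm.inverseʳ (g ^ j))))

  ^-∣ : ∀ (g : Permutation′ n) {m d} → m ∣ d → g ^ m ≈ Perm.id → g ^ d ≈ Perm.id
  ^-∣ g (divides q ≡.refl) g^m≈id = ·-multiple permutationMonoid g^m≈id q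

  -- Source of the symmetry of the orbit relation: (x⁻¹ , k′) undoes (x , k), because powers commute
  -- with conjugation and (gᵏ)^k′ = g.
  unconj-^ : ∀ (x : Permutation′ n) {g h d} → g ^ d ≈ Perm.id → ∀ k k′ s t →
    k ℕ.* k′ ℕ.+ s ℕ.* d ≡ 1 ℕ.+ t ℕ.* d →
    h ≈ flip x ∘ₚ (g ^ k) ∘ₚ x → g ≈ x ∘ₚ (h ^ k′) ∘ₚ flip x
  unconj-^ x {g} {h} g^d≈id k k′ s t kk′≡1 h≈ i = begin
    g ⟨$⟩ʳ i
      ≡⟨ ·-modular-inverse permutationMonoid g^d≈id k k′ s t kk′≡1 i ⟨
    g^kk′ ⟨$⟩ʳ i
      ≡⟨ ≡.cong (g^kk′ ⟨$⟩ʳ_) (Perm.inverseˡ x) ⟨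
    g^kk′ ⟨$⟩ʳ (x ⟨$⟩ˡ (x ⟨$⟩ʳ i))
      ≡⟨ Perm.inverseˡ x ⟨
    x ⟨$⟩ˡ (x ⟨$⟩ʳ (g^kk′ ⟨$⟩ʳ (x ⟨$⟩ˡ (x ⟨$⟩ʳ i))))
      ≡⟨ ≡.cong (x ⟨$⟩ˡ_) (conj-^ x (g ^ k) k′ (x ⟨$⟩ʳ i)) ⟨
    x ⟨$⟩ˡ (((flip x ∘ₚ (g ^ k) ∘ₚ x) ^ k′) ⟨$⟩ʳ (x ⟨$⟩ʳ i))
      ≡⟨ ≡.cong (x ⟨$⟩ˡ_) (×-congʳ k′ h≈ (x ⟨$⟩ʳ i)) ⟨
    x ⟨$⟩ˡ ((h ^ k′) ⟨$⟩ʳ (x ⟨$⟩ʳ i)) ∎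
    where
    open ≡.≡-Reasoning
    g^kk′ = (g ^ k) ^ k′

  module _ {G : Pred (Permutation′ n) 0ℓ} (isGroup : IsPermutationGroup G)
           {order} (|G| : GroupOrder G order) where
    open IsPermutationGroup isGroup

    index : Elt G → Fin order
    index x = proj₁ (proj₂ (proj₂ |G|) x)

    index-reflects : ∀ x y → index x ≡ index y → proj₁ x ≈ proj₁ y
    index-reflects x y eq i =
      ≡.trans (≡.sym (proj₂ (proj₂ (proj₂ |G|) x) ≡.refl i)) (proj₂ (proj₂ (proj₂ |G|) y) eq i)

    power : Elt G → ℕ → Elt G
    power (g , g∈G) k = g ^ k , ^-closed k
      where
      ^-closed : ∀ k → g ^ k ∈ G
      ^-closed zero    = id∈
      ^-closed (suc k) = ∘-closed g∈G (^-closed k)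

    -- Two of the powers with exponents 0, ..., `order` coincide, and the difference of their
    -- exponents kills g. The bound on m serves in `lcm-positive`.
    order-exists : (∀ {ℓ} → ExcludedMiddle ℓ) → ∀ (g : Elt G) → ∃ λ m → m ≤ order × IsOrderOf (proj₁ g) m
    order-exists em x@(g , _)
      with i , j , i<j , eq ← pigeonhole (ℕ.n<1+n order) (index ∘ power x ∘ toℕ)
      with m , m≤k , min ← minimum em {P = λ k → 0 < k × g ^ k ≈ Perm.id} (toℕ j ℕ.∸ toℕ i)
        ( ℕ.m<n⇒0<n∸m i<j
        , ^-cancel g (toℕ i) (toℕ j ℕ.∸ toℕ i)
            (≡.subst (λ k → g ^ k ≈ g ^ toℕ i) (≡.sym (ℕ.m+[n∸m]≡n (ℕ.<⇒≤ i<j)))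
              (index-reflects (power x (toℕ j)) (power x (toℕ i)) (≡.sym eq))) )
      = m , ℕ.≤-trans m≤k (ℕ.≤-trans (ℕ.m∸n≤m (toℕ j) (toℕ i)) (ℕ.≤-pred (Fin.toℕ<n j))) , min

  module Quotient {G N : Pred (Permutation′ n) 0ℓ}
                  (isGroup : IsPermutationGroup G) (N⊴G : IsNormalSubgroup N G) where
    private
      module G = IsPermutationGroup isGroup
    open IsNormalSubgroup N⊴G
    open IsPermutationGroup isPermutationGroup

    infix 4 _∼_
    infixl 7 _∙_

    -- A record, so that the representatives can be inferred.

    record _∼_ (x y : Elt G) : Set where
      constructor coset
      field member : flip (proj₁ x) ∘ₚ proj₁ y ∈ N

    open _∼_ public

    _∙_ : Elt G → Elt G → Elt G
    (x , x∈G) ∙ (y , y∈G) = x ∘ₚ y , G.∘-closed x∈G y∈G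

    ε : Elt G
    ε = Perm.id , G.id∈

    _⁻¹ : Elt G → Elt G
    (x , x∈G) ⁻¹ = flip x , G.⁻¹-closed x∈G

    ≈⇒∼ : ∀ {x y} → proj₁ x ≈ proj₁ y → x ∼ y
    ≈⇒∼ {x , _} {y , _} eq =
      coset (resp (λ i → ≡.trans (≡.sym (Perm.inverseʳ x)) (eq _)) id∈)

    ∼-sym : ∀ {x y} → x ∼ y → y ∼ x
    ∼-sym (coset p) = coset (⁻¹-closed p)

    ∼-trans : ∀ {x y z} → x ∼ y → y ∼ z → x ∼ z
    ∼-trans {y = y , _} {z , _} (coset p) (coset q) =
      coset (resp (λ i → ≡.cong (z ⟨$⟩ʳ_) (Perm.inverseˡ y)) (∘-closed p q))

    -- By normality: (x y)⁻¹ x′ y′ = (y⁻¹ (x⁻¹ x′) y) (y⁻¹ y′).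
    ∙-cong-∼ : ∀ {x x′ y y′} → x ∼ x′ → y ∼ y′ → x ∙ y ∼ x′ ∙ y′
    ∙-cong-∼ {y = y , y∈G} {y′ , _} (coset p) (coset q) =
      coset (resp (λ i → ≡.cong (y′ ⟨$⟩ʳ_) (Perm.inverseˡ y)) (∘-closed (conj-closed y∈G p) q))

    ⁻¹-cong-∼ : ∀ {x x′} → x ∼ x′ → x ⁻¹ ∼ x′ ⁻¹
    ⁻¹-cong-∼ {x , x∈G} {x′ , _} (coset p) =
      coset (resp (λ _ → Perm.inverseˡ x)
        (conj-closed (G.⁻¹-closed x∈G) (⁻¹-closed p)))

    quotientGroup : Group 0ℓ 0ℓ
    quotientGroup = record
      { Carrier = Elt G
      ; _≈_     = _∼_
      ; _∙_     = _∙_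
      ; ε       = ε
      ; _⁻¹     = _⁻¹
      ; isGroup = record
        { isMonoid = record
          { isSemigroup = record
            { isMagma = record
              { isEquivalence = record { refl = ≈⇒∼ λ _ → ≡.refl ; sym = ∼-sym ; trans = ∼-trans }
              ; ∙-cong        = ∙-cong-∼
              }
            ; assoc = λ _ _ _ → ≈⇒∼ λ _ → ≡.refl
            }
          ; identity = (λ _ → ≈⇒∼ λ _ → ≡.refl) , (λ _ → ≈⇒∼ λ _ → ≡.refl)
          }
        ; inverse = (λ (x , _) → ≈⇒∼ λ _ → Perm.inverseʳ x) , (λ (x , _) → ≈⇒∼ λ _ → Perm.inverseˡ x)
        ; ⁻¹-cong = ⁻¹-cong-∼
        }
      }

    ∈⇒∼ε : ∀ {x} → proj₁ x ∈ N → x ∼ ε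
    ∈⇒∼ε p = coset (⁻¹-closed p)

    ∼ε⇒∈ : ∀ {x} → x ∼ ε → proj₁ x ∈ N
    ∼ε⇒∈ (coset p) = ⁻¹-closed p

-- Independence of characters

module Characters (em : ∀ {ℓ} → ExcludedMiddle ℓ) {c ℓ₁ ℓ₂} (K : HeytingField c ℓ₁ ℓ₂) where
  open HeytingField K using (_#_; tight; #⇒invertible; heytingCommutativeRing)
  open CommutativeRing (FieldTheory.commutativeRing K) hiding (zero)
  open Sum +-commutativeMonoid using (sum; sum-cong-≋; sum-remove; ∑-distrib-+)
  open SemiringSum semiring using (*-distribˡ-sum)
  open RingProperties ring using (x∙y⁻¹≈ε⇒x≈y; [y-z]x≈yx-zx; x[y-z]≈xy-xz; -‿distribˡ-*)
  open HeytingProperties heytingCommutativeRing using (x-0≈x; 1#0)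
  open import Relation.Binary.Reasoning.Setoid setoid

  1≉0 : ¬ 1# ≈ 0#
  1≉0 1≈0 = proj₂ (tight 1# 0#) 1≈0 1#0

  cancel-nonzero : ∀ {a b} → ¬ a ≈ 0# → a * b ≈ 0# → b ≈ 0#
  cancel-nonzero {a} {b} a≉0 ab≈0 = cancel (#⇒invertible a#0)
    where
    a#0 : a # 0#
    a#0 = decidable-stable em λ ¬a#0 → a≉0 (proj₁ (tight a 0#) ¬a#0)

    cancel : (∃ λ i → i * (a - 0#) ≈ 1# × (a - 0#) * i ≈ 1#) → b ≈ 0#
    cancel (i , i[a-0]≈1 , _) = begin
      b                   ≈⟨ *-identityˡ b ⟨
      1# * b              ≈⟨ *-congʳ i[a-0]≈1 ⟨
      i * (a - 0#) * b    ≈⟨ *-congʳ (*-congˡ (x-0≈x a)) ⟩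
      i * a * b           ≈⟨ *-assoc i a b ⟩
      i * (a * b)         ≈⟨ *-congˡ ab≈0 ⟩
      i * 0#              ≈⟨ zeroʳ i ⟩
      0#                  ∎

  sum-linear : ∀ {m} t (u v : Fin m → Carrier) →
               sum (λ i → u i - t * v i) ≈ sum u - t * sum v
  sum-linear t u v = begin
    sum (λ i → u i - t * v i)        ≈⟨ sum-cong-≋ (λ i → +-congˡ (-‿distribˡ-* t (v i))) ⟩
    sum (λ i → u i + - t * v i)      ≈⟨ ∑-distrib-+ u (λ i → - t * v i) ⟩
    sum u + sum (λ i → - t * v i)    ≈⟨ +-congˡ (*-distribˡ-sum (- t) v) ⟨
    sum u + - t * sum v              ≈⟨ +-congˡ (-‿distribˡ-* t (sum v)) ⟨
    sum u - t * sum v                ∎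

  sum-splitAt : ∀ k {l} (u : Fin k → Carrier) (v : Fin l → Carrier) →
                sum (λ i → [ u , v ]′ (splitAt k i)) ≈ sum u + sum v
  sum-splitAt zero    u v = sym (+-identityˡ _)
  sum-splitAt (suc k) u v = begin
    u zero + sum (λ i → [ u , v ]′ (splitAt (suc k) (suc i)))
      ≈⟨ +-congˡ (sum-cong-≋ λ i → reflexive ([,]-map (splitAt k i))) ⟩
    u zero + sum (λ i → [ u ∘ suc , v ]′ (splitAt k i))
      ≈⟨ +-congˡ (sum-splitAt k (u ∘ suc) v) ⟩
    u zero + (sum (u ∘ suc) + sum v)
      ≈⟨ +-assoc _ _ _ ⟨
    sum u + sum v ∎

  module _ {x} {X : Set x} (_∙_ : X → X → X) (ε : X) where

    IsCharacter : (X → Carrier) → Set (x ⊔ ℓ₁)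
    IsCharacter χ = (∀ a b → χ (a ∙ b) ≈ χ a * χ b) × χ ε ≈ 1#

    -- The coefficients c i (χ i b − χ 1 b) give a relation that no longer involves χ 1.

    dedekind : ∀ {m} (χ : Fin (suc m) → X → Carrier) → (∀ i → IsCharacter (χ i)) →
               (c : Fin (suc m) → Carrier) → ¬ c zero ≈ 0# →
               (∀ a → sum (λ i → c i * χ i a) ≈ 0#) → ∃ λ i → ∀ a → χ zero a ≈ χ (suc i) a
    dedekind {zero} χ isCharacter c c₀≉0 relation = contradiction c₀≈0 c₀≉0
      where
      c₀≈0 : c zero ≈ 0#
      c₀≈0 = begin
        c zero                      ≈⟨ *-identityʳ _ ⟨
        c zero * 1#                 ≈⟨ *-congˡ (proj₂ (isCharacter zero)) ⟨
        c zero * χ zero ε           ≈⟨ +-identityʳ _ ⟨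
        c zero * χ zero ε + 0#      ≈⟨ relation ε ⟩
        0#                          ∎
    dedekind {suc m} χ isCharacter c c₀≉0 relation = case em em
      where
      1F : Fin (suc (suc m))
      1F = suc zero

      module Eliminate (b : X) where
        t = χ 1F b

        c′ : Fin (suc (suc m)) → Carrier
        c′ i = c i * (χ i b - t)

        term : ∀ a i → c′ i * χ i a ≈ c i * χ i (b ∙ a) - t * (c i * χ i a)
        term a i = begin
          c i * (χ i b - t) * χ i a
            ≈⟨ *-congʳ (x[y-z]≈xy-xz _ _ _) ⟩
          (c i * χ i b - c i * t) * χ i a
            ≈⟨ [y-z]x≈yx-zx _ _ _ ⟩
          c i * χ i b * χ i a - c i * t * χ i a
            ≈⟨ +-cong (trans (*-assoc _ _ _) (*-congˡ (sym (proj₁ (isCharacter i) b a))))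
                      (-‿cong (trans (*-congʳ (*-comm (c i) t)) (*-assoc _ _ _))) ⟩
          c i * χ i (b ∙ a) - t * (c i * χ i a) ∎

        relation′ : ∀ a → sum (λ i → c′ (punchIn 1F i) * χ (punchIn 1F i) a) ≈ 0#
        relation′ a = begin
          sum (λ i → c′ (punchIn 1F i) * χ (punchIn 1F i) a)
            ≈⟨ +-identityˡ _ ⟨
          0# + sum (λ i → c′ (punchIn 1F i) * χ (punchIn 1F i) a)
            ≈⟨ +-congʳ (trans (*-congʳ (trans (*-congˡ (-‿inverseʳ t)) (zeroʳ _))) (zeroˡ _)) ⟨
          c′ 1F * χ 1F a + sum (λ i → c′ (punchIn 1F i) * χ (punchIn 1F i) a)
            ≈⟨ sum-remove {i = 1F} (λ i → c′ i * χ i a) ⟨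
          sum (λ i → c′ i * χ i a)
            ≈⟨ sum-cong-≋ (term a) ⟩
          sum (λ i → c i * χ i (b ∙ a) - t * (c i * χ i a))
            ≈⟨ sum-linear t (λ i → c i * χ i (b ∙ a)) (λ i → c i * χ i a) ⟩
          sum (λ i → c i * χ i (b ∙ a)) - t * sum (λ i → c i * χ i a)
            ≈⟨ +-cong (relation (b ∙ a)) (-‿cong (trans (*-congˡ (relation a)) (zeroʳ t))) ⟩
          0# - 0#
            ≈⟨ -‿inverseʳ 0# ⟩
          0# ∎

      -- As b separates χ 0 from χ 1, the coefficient of χ 0 stays nonzero when χ 1 is dropped. The
      -- index shifts because `punchIn 1F` sends `suc i` to `suc (suc i)`.
      eliminate : ∀ b → ¬ χ zero b ≈ χ 1F b → ∃ λ i → ∀ a → χ zero a ≈ χ (suc i) a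
      eliminate b b≉ = suc (proj₁ found) , proj₂ found
        where
        open Eliminate b
        found = dedekind (χ ∘ punchIn 1F) (isCharacter ∘ punchIn 1F) (c′ ∘ punchIn 1F)
          (λ c₀′≈0 → b≉ (x∙y⁻¹≈ε⇒x≈y _ _ (cancel-nonzero c₀≉0 c₀′≈0))) relation′

      case : Dec (∀ a → χ zero a ≈ χ 1F a) → Dec (∃ λ b → ¬ χ zero b ≈ χ 1F b) →
             ∃ λ i → ∀ a → χ zero a ≈ χ (suc i) a
      case (yes eq) _ = zero , eq
      case (no ¬eq) (no ¬separated) =
        contradiction (λ a → decidable-stable em λ a≉ → ¬separated (a , a≉)) ¬eq
      case (no _) (yes (b , b≉)) = eliminate b b≉

-- Automorphisms and the trace

module Automorphisms
  {c ℓ₁ ℓ₂ c′ ℓ₁′ ℓ₂′} {Q : HeytingField c ℓ₁ ℓ₂} {Ω : HeytingField c′ ℓ₁′ ℓ₂′}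
  {ι : HeytingField.Carrier Q → HeytingField.Carrier Ω}
  (isHom : IsRingHomomorphism (FieldTheory.rawRing Q) (FieldTheory.rawRing Ω) ι)
  where

  open Galois {Q = Q} {Ω = Ω} isHom
  open IntermediateField using (Member; Element)
  open Automorphism using (to)
  private
    module ι = IsRingHomomorphism isHom
  open FieldTheory Ω using (_↑_; sum; Generated; gen; one; add; neg; mul; inv; resp)
  open CommutativeRing (FieldTheory.commutativeRing Ω) hiding (zero)
  open RingProperties ring using (+-inverseʳ-unique; -1*x≈-x)
  open import Relation.Binary.Reasoning.Setoid setoid

  module _ {p} {E : IntermediateField p} where
    private module E = IntermediateField E

    automorphism : (f : Element E → Element E) →
      (∀ {x y} → proj₁ x ≈ proj₁ y → proj₁ (f x) ≈ proj₁ (f y)) →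
      (∀ x y → proj₁ (f (proj₁ x + proj₁ y , E.+-closed (proj₂ x) (proj₂ y))) ≈ proj₁ (f x) + proj₁ (f y)) →
      (∀ x y → proj₁ (f (proj₁ x * proj₁ y , E.*-closed (proj₂ x) (proj₂ y))) ≈ proj₁ (f x) * proj₁ (f y)) →
      (∀ q → proj₁ (f (ι q , E.base q)) ≈ ι q) →
      (∀ {x y} → proj₁ (f x) ≈ proj₁ (f y) → proj₁ x ≈ proj₁ y) →
      (∀ y → ∃ λ x → proj₁ (f x) ≈ proj₁ y) →
      Automorphism E
    automorphism f f-cong f-+ f-* f-base f-injective f-surjective = record
      { to                = f
      ; isRingIsomorphism = record
        { isRingMonomorphism = record
          { isRingHomomorphism = record
            { isSemiringHomomorphism = record
              { isNearSemiringHomomorphism = record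
                { +-isMonoidHomomorphism = record
                  { isMagmaHomomorphism = record
                    { isRelHomomorphism = record { cong = f-cong }
                    ; homo = f-+
                    }
                  ; ε-homo = f-0
                  }
                ; *-homo = f-*
                }
              ; 1#-homo = trans (f-cong (sym ι.1#-homo)) (trans (f-base _) ι.1#-homo)
              }
            ; -‿homo = λ x → +-inverseʳ-unique _ _
                (trans (sym (f-+ _ _)) (trans (f-cong (-‿inverseʳ _)) f-0))
            }
          ; injective = f-injective
          }
        ; surjective = λ y → proj₁ (f-surjective y) , λ eq → trans (f-cong eq) (proj₂ (f-surjective y))
        }
      ; fixes-base = f-base
      }
      where
      f-0 : proj₁ (f (0# , E.resp ι.0#-homo (E.base _))) ≈ 0#
      f-0 = trans (f-cong (sym ι.0#-homo)) (trans (f-base _) ι.0#-homo)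

    module _ (σ : Automorphism E) where
      private module σ = Automorphism σ

      preimage : Element E → Element E
      preimage y = proj₁ (σ.surjective y)

      to-preimage : ∀ y → proj₁ (to σ (preimage y)) ≈ proj₁ y
      to-preimage y = proj₂ (σ.surjective y) refl

      inverse : Automorphism E
      inverse = automorphism preimage
        (λ {x} {y} eq → σ.injective (trans (to-preimage x) (trans eq (sym (to-preimage y)))))
        (λ x y → σ.injective (trans (to-preimage _)
          (sym (trans (σ.+-homo _ _) (+-cong (to-preimage x) (to-preimage y))))))
        (λ x y → σ.injective (trans (to-preimage _)
          (sym (trans (σ.*-homo _ _) (*-cong (to-preimage x) (to-preimage y))))))
        (λ q → σ.injective (trans (to-preimage _) (sym (σ.fixes-base q))))
        (λ {x} {y} eq → trans (sym (to-preimage x)) (trans (σ.⟦⟧-cong eq) (to-preimage y)))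
        (λ y → to σ y , σ.injective (to-preimage _))

      preimage-to : ∀ x → proj₁ (preimage (to σ x)) ≈ proj₁ x
      preimage-to x = σ.injective (to-preimage (to σ x))

      -- `sum` is taken in Ω, whereas σ acts on elements of Ω paired with a proof of membership in
      -- E. Hence the sum, as an element of E, is supplied along with the equations.
      sum-homo : ∀ {m} (v : Fin m → Element E) →
        ∃ λ (s : Element E) → proj₁ s ≈ sum (proj₁ ∘ v) × proj₁ (to σ s) ≈ sum (λ i → proj₁ (to σ (v i)))
      sum-homo {zero}  v = _ , refl , σ.0#-homo
      sum-homo {suc m} v with s , s≈ , σs≈ ← sum-homo (v ∘ suc) =
        _ , +-congˡ s≈ , trans (σ.+-homo (v zero) s) (+-congˡ σs≈)

      ↑-homo : ∀ x k → ∃ λ (s : Element E) → proj₁ s ≈ proj₁ x ↑ k × proj₁ (to σ s) ≈ proj₁ (to σ x) ↑ k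
      ↑-homo x zero    = _ , refl , σ.1#-homo
      ↑-homo x (suc k) with s , s≈ , σs≈ ← ↑-homo x k =
        _ , *-congˡ s≈ , trans (σ.*-homo x s) (*-congˡ σs≈)

      ↑-homo-μ : ∀ x d → proj₁ x ↑ d ≈ 1# → proj₁ (to σ x) ↑ d ≈ 1#
      ↑-homo-μ x d eq with s , s≈ , σs≈ ← ↑-homo x d =
        trans (sym σs≈) (trans (σ.⟦⟧-cong {s} {_ , E.resp ι.1#-homo (E.base _)} (trans s≈ eq)) σ.1#-homo)

  identity : ∀ {p} {E : IntermediateField p} → Automorphism E
  identity = automorphism (λ x → x) (λ eq → eq) (λ _ _ → refl) (λ _ _ → refl) (λ _ → refl)
    (λ eq → eq) (λ y → y , refl)

  module _ (σ : G[Q]) where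
    private module σ = Automorphism σ

    ⟪⟫-cong : ∀ {a b} → a ≈ b → σ ⟪ a ⟫ ≈ σ ⟪ b ⟫
    ⟪⟫-cong = σ.⟦⟧-cong

    ⟪⟫-inverse : ∀ a → σ ⟪ inverse σ ⟪ a ⟫ ⟫ ≈ a
    ⟪⟫-inverse a = to-preimage σ (a , tt)

    inverse-⟪⟫ : ∀ a → inverse σ ⟪ σ ⟪ a ⟫ ⟫ ≈ a
    inverse-⟪⟫ a = preimage-to σ (a , tt)

  -- For an intermediate field this plays the part of normality over Q: every element of G_Q
  -- restricts to it.
  IsStable : ∀ {p} → Pred Carrier p → Set _
  IsStable S = ∀ (σ : G[Q]) {a} → a ∈ S → σ ⟪ a ⟫ ∈ S

  restrict : ∀ {p} {E : IntermediateField p} → IsStable (Member E) → G[Q] → Automorphism E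
  restrict {E = E} stable σ = automorphism (λ (a , a∈E) → σ ⟪ a ⟫ , stable σ a∈E)
    σ.⟦⟧-cong (λ _ _ → σ.+-homo _ _) (λ _ _ → σ.*-homo _ _) σ.fixes-base σ.injective
    (λ (a , a∈E) → (inverse σ ⟪ a ⟫ , stable (inverse σ) a∈E) , ⟪⟫-inverse σ a)
    where module σ = Automorphism σ

  adjoin-stable : ∀ {p} {S : Pred Carrier p} → IsStable S → IsStable (Member (adjoin S))
  adjoin-stable stable σ = go
    where
    module σ = Automorphism σ
    go : ∀ {a} → a ∈ Generated _ → σ ⟪ a ⟫ ∈ Generated _
    go (gen (inj₁ (q , eq))) = gen (inj₁ (q , trans (⟪⟫-cong σ eq) (σ.fixes-base q)))
    go (gen (inj₂ a∈S))      = gen (inj₂ (stable σ a∈S))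
    go (resp eq a)           = resp (⟪⟫-cong σ eq) (go a)
    go one                   = resp (sym σ.1#-homo) one
    go (add a b)             = resp (sym (σ.+-homo _ _)) (add (go a) (go b))
    go (neg a)               = resp (sym (σ.-‿homo _)) (neg (go a))
    go (mul a b)             = resp (sym (σ.*-homo _ _)) (mul (go a) (go b))
    go (inv a eq)            = inv (go a) (trans (sym (σ.*-homo _ _)) (trans (⟪⟫-cong σ eq) σ.1#-homo))

  adjoin-mono : ∀ {p p′} {S : Pred Carrier p} {T : Pred Carrier p′} → S ⊆ T →
                Member (adjoin S) ⊆ Member (adjoin T)
  adjoin-mono S⊆T (gen (inj₁ a∈Q)) = gen (inj₁ a∈Q)
  adjoin-mono S⊆T (gen (inj₂ a∈S)) = gen (inj₂ (S⊆T a∈S))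
  adjoin-mono S⊆T (resp eq a)      = resp eq (adjoin-mono S⊆T a)
  adjoin-mono S⊆T one              = one
  adjoin-mono S⊆T (add a b)        = add (adjoin-mono S⊆T a) (adjoin-mono S⊆T b)
  adjoin-mono S⊆T (neg a)          = neg (adjoin-mono S⊆T a)
  adjoin-mono S⊆T (mul a b)        = mul (adjoin-mono S⊆T a) (adjoin-mono S⊆T b)
  adjoin-mono S⊆T (inv a eq)       = inv (adjoin-mono S⊆T a) eq

  μ-stable : ∀ d → IsStable (μ d)
  μ-stable d σ = ↑-homo-μ σ _ d

  Q⟨μ⟩-stable : ∀ d → IsStable (Member Q⟨μ d ⟩)
  Q⟨μ⟩-stable d = adjoin-stable (μ-stable d)

  Q⟨μ∞⟩-stable : IsStable (Member Q⟨μ∞⟩)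
  Q⟨μ∞⟩-stable = adjoin-stable λ { σ (d , 0<d , eq) → d , 0<d , μ-stable d σ eq }

  Q⟨μ⟩⊆Q⟨μ∞⟩ : ∀ {d} → 0 ℕ.< d → Member Q⟨μ d ⟩ ⊆ Member Q⟨μ∞⟩
  Q⟨μ⟩⊆Q⟨μ∞⟩ {d} 0<d = adjoin-mono λ z∈μ → d , 0<d , z∈μ

  -- The classes are the restrictions of G_Q to M; their number stands in for the degree of M over
  -- Q.
  AgreeOn : ∀ {p} → IntermediateField p → Rel G[Q] _
  AgreeOn M σ τ = ∀ {a} → a ∈ Member M → σ ⟪ a ⟫ ≈ τ ⟪ a ⟫

  module _ (em : ∀ {ℓ} → ExcludedMiddle ℓ) (closure : IsSeparableClosure)
           {p} {M : IntermediateField p} (M-stable : IsStable (Member M)) where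
    open Characters em Ω using (1≉0; IsCharacter; dedekind; sum-splitAt)
    open Sum +-commutativeMonoid using (sum-cong-≋; sum-permute)
    open SemiringSum semiring using (*-distribˡ-sum)
    private module M = IntermediateField M

    module Trace {k} (classes : NumberOfClasses (AgreeOn M) (suc k))
                 {q} {E : IntermediateField q} (M⊆E : Member M ⊆ Member E) (y : Automorphism E) where
      private
        module y = Automorphism y

        h : Fin (suc k) → G[Q]
        h = proj₁ classes

        h-injective : ∀ i j → AgreeOn M (h i) (h j) → i ≡ j
        h-injective i j = proj₁ (proj₂ classes) {i} {j}

        rep : G[Q] → Fin (suc k)
        rep σ = proj₁ (proj₂ (proj₂ classes) σ)

        h-rep : ∀ σ → AgreeOn M (h (rep σ)) σ
        h-rep σ = proj₂ (proj₂ (proj₂ classes) σ) ≡.refl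

      -- Left multiplication by τ on the restrictions to M, read on indices.
      translate : G[Q] → Fin (suc k) → Fin (suc k)
      translate τ i = rep (compose τ (h i))

      translate-inverse : ∀ (τ τ′ : G[Q]) → (∀ a → τ ⟪ τ′ ⟪ a ⟫ ⟫ ≈ a) →
                          ∀ i → translate τ (translate τ′ i) ≡ i
      translate-inverse τ τ′ ττ′≈id i = h-injective (translate τ (translate τ′ i)) i λ {a} a∈M → begin
        h (translate τ (translate τ′ i)) ⟪ a ⟫   ≈⟨ h-rep (compose τ (h (translate τ′ i))) a∈M ⟩
        τ ⟪ h (translate τ′ i) ⟪ a ⟫ ⟫           ≈⟨ ⟪⟫-cong τ (h-rep (compose τ′ (h i)) a∈M) ⟩
        τ ⟪ τ′ ⟪ h i ⟪ a ⟫ ⟫ ⟫                   ≈⟨ ττ′≈id _ ⟩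
        h i ⟪ a ⟫                                ∎

      translation : G[Q] → Permutation′ (suc k)
      translation τ = permutation (translate τ) (translate (inverse τ))
        (translate-inverse τ (inverse τ) (⟪⟫-inverse τ)) (translate-inverse (inverse τ) τ (inverse-⟪⟫ τ))

      trace : Carrier → Carrier
      trace a = sum (λ i → h i ⟪ a ⟫)

      -- τ permutes the restrictions to M, hence the summands of the trace.
      trace-fixed : ∀ {a} → a ∈ M.Member → ∀ (τ : G[Q]) → τ ⟪ trace a ⟫ ≈ trace a
      trace-fixed {a} a∈M τ with s , s≈ , τs≈ ← sum-homo τ (λ i → h i ⟪ a ⟫ , tt) = begin
        τ ⟪ trace a ⟫                      ≈⟨ ⟪⟫-cong τ s≈ ⟨
        proj₁ (to τ s)                     ≈⟨ τs≈ ⟩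
        sum (λ i → τ ⟪ h i ⟪ a ⟫ ⟫)        ≈⟨ sum-cong-≋ (λ i → h-rep (compose τ (h i)) a∈M) ⟨
        sum (λ i → h (translate τ i) ⟪ a ⟫)   ≈⟨ sum-permute (λ i → h i ⟪ a ⟫) (translation τ) ⟨
        trace a                            ∎

      y∘h : Fin (suc k) → Element M → Carrier
      y∘h i (a , a∈M) = proj₁ (to y (h i ⟪ a ⟫ , M⊆E (M-stable (h i) a∈M)))

      h∣M : Fin (suc k) → Element M → Carrier
      h∣M i (a , _) = h i ⟪ a ⟫

      y-fixes-base : ∀ (s : Element E) → (∃ λ q → proj₁ s ≈ ι q) → proj₁ (to y s) ≈ proj₁ s
      y-fixes-base s (q , s≈q) = begin
        proj₁ (to y s)                                    ≈⟨ y.⟦⟧-cong {s} {ι q , IntermediateField.base E q} s≈q ⟩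
        proj₁ (to y (ι q , IntermediateField.base E q))   ≈⟨ y.fixes-base q ⟩
        ι q                                               ≈⟨ s≈q ⟨
        proj₁ s                                           ∎

      -- The trace is fixed by all of G_Q, so it lies in Q because Ω/Q is Galois, and y fixes Q.
      trace-y-fixed : ∀ a → sum (λ i → y∘h i a) ≈ trace (proj₁ a)
      trace-y-fixed (a , a∈M) = begin
        sum (λ i → y∘h i (a , a∈M))   ≈⟨ ys≈ ⟨
        proj₁ (to y s)                ≈⟨ y-fixes-base s (proj₁ tr∈Q , trans s≈ (proj₂ tr∈Q)) ⟩
        proj₁ s                       ≈⟨ s≈ ⟩
        trace a                       ∎
        where
        total = sum-homo y (λ i → h i ⟪ a ⟫ , M⊆E (M-stable (h i) a∈M))
        s     = proj₁ total
        s≈    = proj₁ (proj₂ total)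
        ys≈   = proj₂ (proj₂ total)
        tr∈Q  = IsSeparableClosure.fixedField closure (trace a) (trace-fixed a∈M)

      _·_ : Element M → Element M → Element M
      (a , a∈M) · (b , b∈M) = a * b , M.*-closed a∈M b∈M

      1M : Element M
      1M = 1# , M.resp ι.1#-homo (M.base _)

      -- The h i come first, so that `χ zero` is a restriction with coefficient 1, the nonzero
      -- coefficient required by `dedekind`.
      χ : Fin (suc k ℕ.+ suc k) → Element M → Carrier
      χ i = [ h∣M , y∘h ]′ (splitAt (suc k) i)

      coefficient : Fin (suc k ℕ.+ suc k) → Carrier
      coefficient i = [ const 1# , const (- 1#) ]′ (splitAt (suc k) i)

      isCharacter : ∀ i → IsCharacter _·_ 1M (χ i)
      isCharacter i with splitAt (suc k) i
      ... | inj₁ j = (λ _ _ → Automorphism.*-homo (h j) _ _) , Automorphism.1#-homo (h j)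
      ... | inj₂ j =
        (λ _ _ → trans (y.⟦⟧-cong (Automorphism.*-homo (h j) _ _)) (y.*-homo _ _)) ,
        trans (y.⟦⟧-cong (Automorphism.1#-homo (h j))) y.1#-homo

      relation : ∀ a → sum (λ i → coefficient i * χ i a) ≈ 0#
      relation a = begin
        sum (λ i → coefficient i * χ i a)
          ≈⟨ sum-cong-≋ (λ i → term (splitAt (suc k) i)) ⟩
        sum (λ i → [ (λ j → 1# * h∣M j a) , (λ j → - 1# * y∘h j a) ]′ (splitAt (suc k) i))
          ≈⟨ sum-splitAt (suc k) _ _ ⟩
        sum (λ j → 1# * h∣M j a) + sum (λ j → - 1# * y∘h j a)
          ≈⟨ +-cong (sum-cong-≋ (λ j → *-identityˡ (h∣M j a))) (sym (*-distribˡ-sum (- 1#) (λ j → y∘h j a))) ⟩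
        trace (proj₁ a) + - 1# * sum (λ j → y∘h j a)
          ≈⟨ +-congˡ (trans (-1*x≈-x _) (-‿cong (trace-y-fixed a))) ⟩
        trace (proj₁ a) - trace (proj₁ a)
          ≈⟨ -‿inverseʳ _ ⟩
        0# ∎
        where
        term : ∀ s → [ const 1# , const (- 1#) ]′ s * [ h∣M , y∘h ]′ s a ≈
               [ (λ j → 1# * h∣M j a) , (λ j → - 1# * y∘h j a) ]′ s
        term (inj₁ _) = refl
        term (inj₂ _) = refl

      -- The h i are pairwise distinct on M, so the character equal to h 0 must be one of the y ∘ h
      -- j.
      dependence : (∃ λ i → ∀ a → χ zero a ≈ χ (suc i) a) → ∃₂ λ i j → ∀ a → h∣M i a ≈ y∘h j a
      dependence (i , eq) with splitAt k i
      ... | inj₁ j = contradiction (h-injective zero (suc j) λ {a} a∈M → eq (a , a∈M)) λ ()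
      ... | inj₂ j = zero , j , eq

      -- From h i = y ∘ h j on M follows y = h i ∘ (h j)⁻¹ on M, since (h j)⁻¹ maps M into itself.
      y-is-Galois : (∃₂ λ i j → ∀ a → h∣M i a ≈ y∘h j a) →
        ∃ λ (σ : G[Q]) → ∀ {a} (a∈M : a ∈ Member M) → proj₁ (to y (a , M⊆E a∈M)) ≈ σ ⟪ a ⟫
      y-is-Galois (i , j , eq) = compose (h i) (inverse (h j)) , λ {a} a∈M →
        let b∈M = M-stable (inverse (h j)) a∈M ; b = inverse (h j) ⟪ a ⟫ in begin
        proj₁ (to y (a , M⊆E a∈M))
          ≈⟨ y.⟦⟧-cong {a , M⊆E a∈M} {h j ⟪ b ⟫ , M⊆E (M-stable (h j) b∈M)} (sym (⟪⟫-inverse (h j) a)) ⟩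
        y∘h j (b , b∈M)
          ≈⟨ eq (b , b∈M) ⟨
        h i ⟪ inverse (h j) ⟪ a ⟫ ⟫ ∎

    -- The trace over the finite group of restrictions to M takes values in Q, so it is
    -- fixed by y.  If y were none of these restrictions, the resulting relation
    -- between distinct characters of M would contradict their independence.

    agrees-with-Galois : ∀ {k} → NumberOfClasses (AgreeOn M) k →
      ∀ {q} {E : IntermediateField q} (M⊆E : Member M ⊆ Member E) (y : Automorphism E) →
      ∃ λ (σ : G[Q]) → ∀ {a} (a∈M : a ∈ Member M) → proj₁ (to y (a , M⊆E a∈M)) ≈ σ ⟪ a ⟫
    -- The identity must have a representative, so there is at least one class.
    agrees-with-Galois {zero} (_ , _ , surjective) _ _ with () ← proj₁ (surjective identity)
    agrees-with-Galois {suc k} classes M⊆E y = y-is-Galois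
      (dependence (dedekind _·_ 1M χ isCharacter coefficient 1≉0 relation))
      where open Trace classes M⊆E y

-- The fibre product

module Surjections
  {c ℓ₁ ℓ₂ c′ ℓ₁′ ℓ₂′} {Q : HeytingField c ℓ₁ ℓ₂} {Ω : HeytingField c′ ℓ₁′ ℓ₂′}
  {ι : HeytingField.Carrier Q → HeytingField.Carrier Ω}
  (isHom : IsRingHomomorphism (FieldTheory.rawRing Q) (FieldTheory.rawRing Ω) ι)
  {n : ℕ} {G : Pred (Permutation′ n) 0ℓ} (isGroup : IsPermutationGroup G)
  where

  open Galois {Q = Q} {Ω = Ω} isHom
  open Automorphisms {Q = Q} {Ω = Ω} isHom
  open IntermediateField using (Member)
  open Automorphism using (to)
  open FieldTheory Ω using (_↑_)
  open CommutativeRing (FieldTheory.commutativeRing Ω)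
    using (_≈_; refl; sym; trans; 1#; *-identityʳ; *-monoid)
  open Mult *-monoid using () renaming (×-congʳ to ↑-congˡ)
  private
    module G = IsPermutationGroup isGroup

  module Kernel {N : Pred (Permutation′ n) 0ℓ} (N⊴G : IsNormalSubgroup N G)
                (φ : ContinuousSurjection isGroup N) where
    open ContinuousSurjection φ public
    open Quotient isGroup N⊴G public
    open Group quotientGroup public using () renaming
      (refl to ∼-refl; identityˡ to ∙-identityˡ; inverseˡ to ∙-inverseˡ; setoid to quotientSetoid)
    open GroupProperties quotientGroup using (identityˡ-unique; inverseˡ-unique)
    open import Relation.Binary.Reasoning.Setoid quotientSetoid
    private module φ = IsMagmaHomomorphism isHomomorphism

    ⟦⟧-cong : ∀ {σ τ : G[Q]} → (∀ a → σ ⟪ a ⟫ ≈ τ ⟪ a ⟫) → ⟦ σ ⟧ ∼ ⟦ τ ⟧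
    ⟦⟧-cong {σ} {τ} eq = coset (φ.⟦⟧-cong {σ} {τ} λ (a , _) → eq a)

    ⟦⟧-homo : ∀ (σ τ : G[Q]) → ⟦ compose σ τ ⟧ ∼ ⟦ σ ⟧ ∙ ⟦ τ ⟧
    ⟦⟧-homo σ τ = coset (φ.homo σ τ)

    ⟦⟧-surjective : ∀ x → ∃ λ σ → ⟦ σ ⟧ ∼ x
    ⟦⟧-surjective x = proj₁ (surjective x) , coset (proj₂ (surjective x) {proj₁ (surjective x)} λ _ → refl)

    -- φ is given as a map of magmas. The image of the identity is idempotent, hence trivial in the
    -- group G/N, and the rule for inverses follows.
    ⟦identity⟧ : ⟦ identity ⟧ ∼ ε
    ⟦identity⟧ = identityˡ-unique ⟦ identity ⟧ ⟦ identity ⟧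
      (∼-trans (∼-sym (⟦⟧-homo identity identity)) (⟦⟧-cong {compose identity identity} {identity} λ _ → refl))

    ⟦inverse⟧ : ∀ (σ : G[Q]) → ⟦ inverse σ ⟧ ∼ ⟦ σ ⟧ ⁻¹
    ⟦inverse⟧ σ = inverseˡ-unique ⟦ inverse σ ⟧ ⟦ σ ⟧ (begin
      ⟦ inverse σ ⟧ ∙ ⟦ σ ⟧        ≈⟨ ⟦⟧-homo (inverse σ) σ ⟨
      ⟦ compose (inverse σ) σ ⟧    ≈⟨ ⟦⟧-cong {compose (inverse σ) σ} {identity} (inverse-⟪⟫ σ) ⟩
      ⟦ identity ⟧                 ≈⟨ ⟦identity⟧ ⟩
      ε                            ∎)

    ⟦left-division⟧ : ∀ (σ τ : G[Q]) → ⟦ compose (inverse σ) τ ⟧ ∼ ⟦ σ ⟧ ⁻¹ ∙ ⟦ τ ⟧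
    ⟦left-division⟧ σ τ = ∼-trans (⟦⟧-homo (inverse σ) τ) (∙-cong-∼ (⟦inverse⟧ σ) ∼-refl)

    ⟦conjugate⟧ : ∀ (σ τ : G[Q]) → ⟦ compose (inverse τ) (compose σ τ) ⟧ ∼ ⟦ τ ⟧ ⁻¹ ∙ (⟦ σ ⟧ ∙ ⟦ τ ⟧)
    ⟦conjugate⟧ σ τ = ∼-trans (⟦left-division⟧ τ (compose σ τ)) (∙-cong-∼ ∼-refl (⟦⟧-homo σ τ))

    private
      Qφ = Q⟨φ⟩ isGroup φ

    ∼⇒agree : ∀ {σ τ} → ⟦ σ ⟧ ∼ ⟦ τ ⟧ → AgreeOn Qφ σ τ
    ∼⇒agree {σ} {τ} σ∼τ {a} a∈Qφ = trans
      (⟪⟫-cong σ (sym (a∈Qφ (compose (inverse σ) τ) (∼ε⇒∈ (begin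
        ⟦ compose (inverse σ) τ ⟧   ≈⟨ ⟦left-division⟧ σ τ ⟩
        ⟦ σ ⟧ ⁻¹ ∙ ⟦ τ ⟧            ≈⟨ ∙-cong-∼ ∼-refl σ∼τ ⟨
        ⟦ σ ⟧ ⁻¹ ∙ ⟦ σ ⟧            ≈⟨ ∙-inverseˡ ⟦ σ ⟧ ⟩
        ε                           ∎)))))
      (⟪⟫-inverse σ (τ ⟪ a ⟫))

    -- The kernel is normal: σ τ a = τ (τ⁻¹ σ τ) a, and τ⁻¹ σ τ again fixes Q(φ).
    Qφ-stable : IsStable (Member Qφ)
    Qφ-stable τ {a} a∈Qφ σ σ∈ker = trans (sym (⟪⟫-inverse τ (σ ⟪ τ ⟪ a ⟫ ⟫)))
      (⟪⟫-cong τ (a∈Qφ (compose (inverse τ) (compose σ τ)) (∼ε⇒∈ (begin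
        ⟦ compose (inverse τ) (compose σ τ) ⟧   ≈⟨ ⟦conjugate⟧ σ τ ⟩
        ⟦ τ ⟧ ⁻¹ ∙ (⟦ σ ⟧ ∙ ⟦ τ ⟧)              ≈⟨ ∙-cong-∼ ∼-refl (∙-cong-∼ (∈⇒∼ε σ∈ker) ∼-refl) ⟩
        ⟦ τ ⟧ ⁻¹ ∙ (ε ∙ ⟦ τ ⟧)                  ≈⟨ ∙-cong-∼ ∼-refl (∙-identityˡ ⟦ τ ⟧) ⟩
        ⟦ τ ⟧ ⁻¹ ∙ ⟦ τ ⟧                        ≈⟨ ∙-inverseˡ ⟦ τ ⟧ ⟩
        ε                                       ∎))))

    module _ (d : ℕ) where
      private
        Mφ = M⟨φ⟩ isGroup φ d

      Mφ-stable : IsStable (Member Mφ)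
      Mφ-stable σ (a∈Qφ , a∈Qμ) = Qφ-stable σ a∈Qφ , Q⟨μ⟩-stable d σ a∈Qμ

      -- In the fibre product, α may be replaced by a σ in G_Q that restricts to it.

      fibreProduct : ∀ {x k} → Coprime k d → (σ : G[Q]) → ⟦ σ ⟧ ∼ x → (y : Automorphism Q⟨μ d ⟩) →
        (∀ ζ → proj₁ ζ ∈ μ d → proj₁ (to y ζ) ≈ proj₁ ζ ↑ k) →
        (∀ a → a ∈ Member Qφ → (a∈Qμ : a ∈ Member Q⟨μ d ⟩) → σ ⟪ a ⟫ ≈ proj₁ (to y (a , a∈Qμ))) →
        FibreProduct isGroup φ d x k
      fibreProduct k⊥d σ σ∼x y y-cyclotomic agree =
        k⊥d , restrict {E = Qφ} Qφ-stable σ , y , (σ , member σ∼x , λ _ → refl) ,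
        y-cyclotomic , λ (a , p , q) → agree a p q

      fibreProduct-ε : FibreProduct isGroup φ d ε 1
      fibreProduct-ε = fibreProduct (Coprimality.1-coprimeTo d) identity ⟦identity⟧ identity
        (λ (ζ , _) _ → sym (*-identityʳ ζ)) (λ _ _ _ → refl)

      -- Inverses in the fibre product. The congruence for k′ is returned because symmetry of the
      -- orbit relation must also undo the k-th power on permutations.
      fibreProduct-⁻¹ : ∀ {x k} → FibreProduct isGroup φ d x k →
        ∃ λ k′ → FibreProduct isGroup φ d (x ⁻¹) k′ × ∃₂ λ s t → k ℕ.* k′ ℕ.+ s ℕ.* d ≡ 1 ℕ.+ t ℕ.* d
      fibreProduct-⁻¹ {x} {k} (k⊥d , α , y , (σ , σ∼x , α≈σ) , y-cyclotomic , agree) =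
        k′ , fibreProduct {x ⁻¹} {k′} k′⊥d (inverse σ) (∼-trans (⟦inverse⟧ σ) (⁻¹-cong-∼ (coset σ∼x)))
          (inverse y) y⁻¹-cyclotomic agree⁻¹ , s , t , kk′≡1
        where
        modular = coprime-inverse k⊥d
        k′      = proj₁ modular
        k′⊥d    = proj₁ (proj₂ modular)
        s       = proj₁ (proj₂ (proj₂ modular))
        t       = proj₁ (proj₂ (proj₂ (proj₂ modular)))
        kk′≡1   = proj₂ (proj₂ (proj₂ (proj₂ modular)))
        module y = Automorphism y

        -- With η = y⁻¹ ζ, again a d-th root of unity, ζ = ηᵏ and so ζ^k′ = η.
        y⁻¹-cyclotomic : ∀ ζ → proj₁ ζ ∈ μ d → proj₁ (to (inverse y) ζ) ≈ proj₁ ζ ↑ k′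
        y⁻¹-cyclotomic ζ ζ∈μ = sym (trans
          (↑-congˡ k′ (trans (sym (to-preimage y ζ)) (y-cyclotomic (preimage y ζ) η∈μ)))
          (·-modular-inverse *-monoid η∈μ k k′ s t kk′≡1))
          where
          η∈μ : proj₁ (preimage y ζ) ∈ μ d
          η∈μ = ↑-homo-μ (inverse y) ζ d ζ∈μ

        -- It suffices to compare images under y: b = σ⁻¹ a lies in M, where y agrees with σ, so y b
        -- = σ b = a.
        agree⁻¹ : ∀ a → a ∈ Member Qφ → (a∈Qμ : a ∈ Member Q⟨μ d ⟩) →
                  inverse σ ⟪ a ⟫ ≈ proj₁ (to (inverse y) (a , a∈Qμ))
        agree⁻¹ a a∈Qφ a∈Qμ = y.injective {b , proj₂ b∈M} {preimage y (a , a∈Qμ)}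
          (trans (sym (agree (b , b∈M)))
            (trans (α≈σ (b , proj₁ b∈M)) (trans (⟪⟫-inverse σ a) (sym (to-preimage y (a , a∈Qμ))))))
          where
          b = inverse σ ⟪ a ⟫
          b∈M = Mφ-stable (inverse σ) (a∈Qφ , a∈Qμ)

      module _ (ef : ExponentFunction G) where

        -- Stated for two elements with equal permutations, since members of `S-min` also carry
        -- proofs and `index-reflects` compares permutations alone.
        sameOrbit-reflexive : ∀ {g h : S-min ef N} → elem (proj₁ g) Perm.≈ elem (proj₁ h) →
                              SameOrbit isGroup φ ef d g h
        sameOrbit-reflexive g≈h = ε , 1 , fibreProduct-ε , λ i → ≡.sym (g≈h i)

        sameOrbit-sym : (∀ (g : S-min ef N) → elem (proj₁ g) ^ d Perm.≈ Perm.id) →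
                        ∀ {g h} → SameOrbit isGroup φ ef d g h → SameOrbit isGroup φ ef d h g
        sameOrbit-sym g^d≈id {g} {h} (x@(x₀ , _) , k , x∈FP , h≈) =
          x ⁻¹ , k′ , proj₁ (proj₂ inverted) ,
          unconj-^ x₀ (g^d≈id g) k k′ s t kk′≡1 h≈
          where
          inverted = fibreProduct-⁻¹ {x} {k} x∈FP
          k′       = proj₁ inverted
          s        = proj₁ (proj₂ (proj₂ inverted))
          t        = proj₁ (proj₂ (proj₂ (proj₂ inverted)))
          kk′≡1    = proj₂ (proj₂ (proj₂ (proj₂ inverted)))

-- Enlarging the kernel

module _ {n : ℕ} {G : Pred (Permutation′ n) 0ℓ} (isGroup : IsPermutationGroup G)
         (ef : ExponentFunction G) where
  open ExponentFunction ef using (exp)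
  open IsPermutationGroup isGroup

  improper : IsNormalSubgroup G G
  improper = record
    { isPermutationGroup = isGroup
    ; N⊆G                = λ g∈G → g∈G
    ; conj-closed        = λ x∈G g∈G → ∘-closed (⁻¹-closed x∈G) (∘-closed g∈G x∈G)
    }

  -- exp(N′) is squeezed between exp(G) and exp(N), which coincide.
  isExpOf-superset : ∀ {N N′ v} → N ⊆ N′ → IsExpOf ef N v → IsExpOf ef G v → IsExpOf ef N′ v
  isExpOf-superset N⊆N′ ((g , g∈N , eq) , _) (_ , min) =
    (g , N⊆N′ g∈N , eq) , λ { k (h , _ , eq) → min k (h , mem h , eq) }

  S-min-exp : ∀ {N v} → IsExpOf ef N v → ((g , _) : S-min ef N) → exp g ≡ v
  S-min-exp (attained , min) (_ , _ , attained′ , min′) =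
    ℕ.≤-antisym (min′ _ attained) (min _ attained′)

  S-min-mono : ∀ {N N′ v} → N ⊆ N′ → IsExpOf ef N v → IsExpOf ef N′ v → S-min ef N → S-min ef N′
  S-min-mono N⊆N′ N-exp N′-exp g@(g₀ , g∈N , _) =
    g₀ , N⊆N′ g∈N , ≡.subst (IsExpOf ef _) (≡.sym (S-min-exp N-exp g)) N′-exp

  module _ (em : ∀ {ℓ} → ExcludedMiddle ℓ) {order} (|G| : GroupOrder G order)
           {d} (d-lcm : IsLCM (MinimalOrder ef) d) where

    -- As exp(N) = exp(G), the order of g is among the numbers whose lcm is d.
    S-min-^ : ∀ {N v} → IsExpOf ef N v → IsExpOf ef G v →
              ((g , _) : S-min ef N) → elem g ^ d Perm.≈ Perm.id
    S-min-^ N-exp G-exp s@(g , _)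
      with m , _ , g-order ← order-exists isGroup |G| em (elem g , mem g) =
      ^-∣ (elem g)
        (proj₁ d-lcm m (g , ≡.subst (IsExpOf ef G) (≡.sym (S-min-exp N-exp s)) G-exp , g-order))
        (proj₂ (proj₁ g-order))

    -- Needed for Q(μ_d) ⊆ Q(μ_∞), since `μ∞` asks for positive exponents. The common multiple |G|!
    -- is nonzero, and it makes the bound ord(g) ≤ |G| suffice in place of Lagrange's theorem.
    lcm-positive : 0 < d
    lcm-positive = ℕ.n≢0⇒n>0 λ { ≡.refl → ℕ.≢-nonZero⁻¹ (order !) {{ℕ._!≢0 order}}
      (∣.0∣⇒≡0 (proj₂ d-lcm (order !) divides-order!)) }
      where
      ∣! : ∀ {m} → 0 < m → m ∣ m !
      ∣! {suc m} _ = ∣.m∣m*n (m !)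

      divides-order! : ∀ m → MinimalOrder ef m → m ∣ order !
      divides-order! m (g , _ , (0<m , _) , min)
        with m′ , m′≤order , g-order , _ ← order-exists isGroup |G| em (elem g , mem g) =
        ∣.∣-trans (∣! 0<m) (∣.m≤n⇒m!∣n! (ℕ.≤-trans (min m′ g-order) m′≤order))

module MaximalValue
  (em : ∀ {ℓ} → ExcludedMiddle ℓ)
  {c ℓ₁ ℓ₂ c′ ℓ₁′ ℓ₂′} {Q : HeytingField c ℓ₁ ℓ₂} {Ω : HeytingField c′ ℓ₁′ ℓ₂′}
  {ι : HeytingField.Carrier Q → HeytingField.Carrier Ω}
  (isHom : IsRingHomomorphism (FieldTheory.rawRing Q) (FieldTheory.rawRing Ω) ι)
  (closure : Galois.IsSeparableClosure {Q = Q} {Ω = Ω} isHom)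
  {n : ℕ} {G : Pred (Permutation′ n) 0ℓ} (isGroup : IsPermutationGroup G)
  {order} (|G| : GroupOrder G order)
  (ef : ExponentFunction G) {d : ℕ} (d-lcm : IsLCM (MinimalOrder ef) d)
  where

  open Galois {Q = Q} {Ω = Ω} isHom
  open Automorphisms {Q = Q} {Ω = Ω} isHom
  open Surjections {Q = Q} {Ω = Ω} isHom isGroup
  open IntermediateField using (Member)
  open Automorphism using (to)
  open CommutativeRing (FieldTheory.commutativeRing Ω) using (_≈_; refl; sym; trans)
  private
    module G = IsPermutationGroup isGroup

  -- Existence and boundedness of b(π, φ)

  module _ {N : Pred (Permutation′ n) 0ℓ} (N⊴G : IsNormalSubgroup N G)
           (φ : ContinuousSurjection isGroup N) where
    open Kernel N⊴G φ using (sameOrbit-reflexive; sameOrbit-sym)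
    private
      indexOf : S-min ef N → Fin order
      indexOf (g , _) = index isGroup |G| (elem g , mem g)

      indexOf-reflects : ∀ {g h} → indexOf g ≡ indexOf h → SameOrbit isGroup φ ef d g h
      indexOf-reflects {g} {h} eq =
        sameOrbit-reflexive d ef {g} {h} (index-reflects isGroup |G| _ _ eq)

    -- The bound on irredundant families is kept for `enlarge`, where the representatives for N form
    -- such a family for N′.
    b-exists : ∀ {v} → IsExpOf ef N v → IsExpOf ef G v →
      ∃ λ b → IsB isGroup φ ef d b ×
        (∀ {j} (f : Fin j → S-min ef N) → Injective _≡_ (SameOrbit isGroup φ ef d) f → j ≤ b)
    b-exists N-exp G-exp = countClasses em
      (λ {g} {h} → sameOrbit-sym d ef (S-min-^ isGroup ef em |G| d-lcm N-exp G-exp) {g} {h})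
      indexOf (λ {g} {h} → indexOf-reflects {g} {h})

    b-bounded : ∀ {b} → IsB isGroup φ ef d b → b ≤ order
    b-bounded (f , f-injective , _) =
      injective⇒≤ λ {i} {j} eq → f-injective (indexOf-reflects {f i} {f j} eq)

  -- The surjection φ′ with kernel enlarged to N′

  module Enlarge {N : Pred (Permutation′ n) 0ℓ} (N⊴G : IsNormalSubgroup N G)
                 (φ : ContinuousSurjection isGroup N) where
    open Kernel N⊴G φ
    private
      M = M⟨φ⟩ isGroup φ d

      M-stable : IsStable (Member M)
      M-stable = Mφ-stable d

    Fixes : Pred G[Q] _
    Fixes σ = ∀ a → a ∈ Member M → σ ⟪ a ⟫ ≈ a

    -- Membership in the preimage of Gal(Q(φ)/M), expressed by elements of G_Q so that no
    -- automorphism of Q(φ) has to be lifted.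
    InImage : Pred (Permutation′ n) _
    InImage x = ∃ λ (x∈G : x ∈ G) → ∃ λ σ → Fixes σ × ⟦ σ ⟧ ∼ (x , x∈G)

    -- Excluded middle brings the predicate down to level 0.

    N′ : Pred (Permutation′ n) 0ℓ
    N′ x = True (em {P = InImage x})

    N′-intro : ∀ {x} → InImage x → x ∈ N′
    N′-intro = fromWitness

    N′-elim : ∀ {x} → x ∈ N′ → InImage x
    N′-elim = toWitness

    N⊆N′ : N ⊆ N′
    N⊆N′ x∈N = N′-intro
      (IsNormalSubgroup.N⊆G N⊴G x∈N , identity , (λ _ _ → refl) , ∼-trans ⟦identity⟧ (∼-sym (∈⇒∼ε x∈N)))

    N′⊴G : IsNormalSubgroup N′ G
    N′⊴G = record
      { isPermutationGroup = record
        { resp      = λ eq x∈N′ → N′-intro (resp′ eq (N′-elim x∈N′))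
        ; id∈       = N′-intro (G.id∈ , identity , (λ _ _ → refl) , ⟦identity⟧)
        ; ∘-closed  = λ x∈N′ y∈N′ → N′-intro (∘-closed′ (N′-elim x∈N′) (N′-elim y∈N′))
        ; ⁻¹-closed = λ x∈N′ → N′-intro (⁻¹-closed′ (N′-elim x∈N′))
        }
      ; N⊆G         = λ x∈N′ → proj₁ (N′-elim x∈N′)
      ; conj-closed = λ x∈G g∈N′ → N′-intro (conj-closed′ x∈G (N′-elim g∈N′))
      }
      where
      resp′ : ∀ {x y} → x Perm.≈ y → InImage x → InImage y
      resp′ eq (x∈G , σ , σ-fixes , σ∼x) =
        G.resp eq x∈G , σ , σ-fixes , ∼-trans σ∼x (≈⇒∼ eq)

      ∘-closed′ : ∀ {x y} → InImage x → InImage y → InImage (x ∘ₚ y)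
      ∘-closed′ (x∈G , σ , σ-fixes , σ∼x) (y∈G , τ , τ-fixes , τ∼y) =
        G.∘-closed x∈G y∈G , compose σ τ ,
        (λ a a∈M → trans (⟪⟫-cong σ (τ-fixes a a∈M)) (σ-fixes a a∈M)) ,
        ∼-trans (⟦⟧-homo σ τ) (∙-cong-∼ σ∼x τ∼y)

      ⁻¹-closed′ : ∀ {x} → InImage x → InImage (flip x)
      ⁻¹-closed′ (x∈G , σ , σ-fixes , σ∼x) =
        G.⁻¹-closed x∈G , inverse σ ,
        (λ a a∈M → trans (⟪⟫-cong (inverse σ) (sym (σ-fixes a a∈M))) (inverse-⟪⟫ σ a)) ,
        ∼-trans (⟦inverse⟧ σ) (⁻¹-cong-∼ σ∼x)

      -- If τ represents x, then τ⁻¹ σ τ fixes M because τ maps M into itself.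
      conj-closed′ : ∀ {x g} → x ∈ G → InImage g → InImage (flip x ∘ₚ g ∘ₚ x)
      conj-closed′ {x} x∈G (g∈G , σ , σ-fixes , σ∼g) =
        G.∘-closed (G.⁻¹-closed x∈G) (G.∘-closed g∈G x∈G) , compose (inverse τ) (compose σ τ) ,
        (λ a a∈M → trans (⟪⟫-cong (inverse τ) (σ-fixes (τ ⟪ a ⟫) (M-stable τ a∈M))) (inverse-⟪⟫ τ a)) ,
        ∼-trans (⟦conjugate⟧ σ τ) (∙-cong-∼ (⁻¹-cong-∼ τ∼x) (∙-cong-∼ σ∼g τ∼x))
        where
        τ = proj₁ (⟦⟧-surjective (x , x∈G))
        τ∼x = proj₂ (⟦⟧-surjective (x , x∈G))

    -- Cosets of N and of N′ are both represented by elements of G, so G_Q → G/N → G/N′ has the same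
    -- underlying map as φ and each law passes along N ⊆ N′.
    φ′ : ContinuousSurjection isGroup N′
    φ′ = record
      { ⟦_⟧            = ⟦_⟧
      ; isHomomorphism = record
        { isRelHomomorphism = record
          { cong = λ {σ} {τ} σ≈τ → N⊆N′ (member (⟦⟧-cong {σ} {τ} λ a → σ≈τ (a , _))) }
        ; homo = λ σ τ → N⊆N′ (member (⟦⟧-homo σ τ))
        }
      ; surjective     = λ x → proj₁ (surjective x) , λ {σ} σ≈ → N⊆N′ (proj₂ (surjective x) {σ} σ≈)
      ; continuous     = λ σ → proj₁ (continuous σ) , λ τ τ≈σ → N⊆N′ (proj₂ (continuous σ) τ τ≈σ)
      }

    private
      module K′ = Kernel N′⊴G φ′

    -- σ⁻¹ τ fixes M, so its image under φ lies in N′.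
    agree⇒∼′ : ∀ {σ τ} → AgreeOn M σ τ → ⟦ σ ⟧ K′.∼ ⟦ τ ⟧
    agree⇒∼′ {σ} {τ} σ≈τ = K′.coset (N′-intro
      ( G.∘-closed (G.⁻¹-closed (proj₂ ⟦ σ ⟧)) (proj₂ ⟦ τ ⟧) , compose (inverse σ) τ
      , (λ a a∈M → trans (⟪⟫-cong (inverse σ) (sym (σ≈τ a∈M))) (inverse-⟪⟫ σ a))
      , ⟦left-division⟧ σ τ ))

    -- If φ(σ) lies in N′, then σ agrees on Q(φ) with some ρ that fixes M.
    M⊆Qφ′ : Member M ⊆ Member (Q⟨φ⟩ isGroup φ′)
    M⊆Qφ′ {a} (a∈Qφ , a∈Qμ) σ σ∈N′ = fixed (N′-elim σ∈N′)
      where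
      fixed : InImage (proj₁ ⟦ σ ⟧) → σ ⟪ a ⟫ ≈ a
      fixed (_ , ρ , ρ-fixes , coset ρ∼σ) =
        trans (sym (∼⇒agree {ρ} {σ} (coset ρ∼σ) a∈Qφ)) (ρ-fixes a (a∈Qφ , a∈Qμ))

    -- σ represents x only modulo N′. The discrepancy φ(σ)⁻¹ x is φ(ρ) for some ρ that fixes M, so σ
    -- ρ represents x modulo N and still agrees with y on M.
    fibreProduct-φ′⇒φ : ∀ {x k} → FibreProduct isGroup φ′ d x k → FibreProduct isGroup φ d x k
    fibreProduct-φ′⇒φ {x@(_ , x∈G)} {k} (k⊥d , α , y , (σ , σ∼′x , α≈σ) , y-cyclotomic , agree) =
      lift (N′-elim σ∼′x)
      where
      lift : InImage (flip (proj₁ ⟦ σ ⟧) ∘ₚ proj₁ x) → FibreProduct isGroup φ d x k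
      lift (_ , ρ , ρ-fixes , coset ρ∼σ⁻¹x) = fibreProduct d {x} {k} k⊥d (compose σ ρ)
        (∼-trans (⟦⟧-homo σ ρ) (∼-trans (∙-cong-∼ {⟦ σ ⟧} {⟦ σ ⟧} {⟦ ρ ⟧} {⟦ σ ⟧ ⁻¹ ∙ x} ∼-refl (coset ρ∼σ⁻¹x))
          (≈⇒∼ λ i → ≡.cong (proj₁ x ⟨$⟩ʳ_) (Perm.inverseˡ (proj₁ ⟦ σ ⟧)))))
        y y-cyclotomic
        λ a a∈Qφ a∈Qμ → trans (⟪⟫-cong σ (ρ-fixes a (a∈Qφ , a∈Qμ)))
          (trans (sym (α≈σ (a , M⊆Qφ′ (a∈Qφ , a∈Qμ)))) (agree (a , M⊆Qφ′ (a∈Qφ , a∈Qμ) , a∈Qμ)))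

    module _ {p} {E : IntermediateField p} (E-stable : IsStable (Member E)) (M⊆E : Member M ⊆ Member E) where

      -- φ(σ) determines σ on Q(φ), which contains M, so there are at most |G| restrictions.
      restrictionClasses : ∃ λ k → NumberOfClasses (AgreeOn M) k
      restrictionClasses = proj₁ counted , proj₁ (proj₂ counted)
        where
        counted = countClasses em {_~_ = AgreeOn M} (λ σ≈τ a∈M → sym (σ≈τ a∈M))
          (λ σ → index isGroup |G| ⟦ σ ⟧)
          (λ {σ} {τ} eq {a} a∈M →
            ∼⇒agree {σ} {τ} (≈⇒∼ (index-reflects isGroup |G| ⟦ σ ⟧ ⟦ τ ⟧ eq)) (proj₁ a∈M))

      -- Agrees with y on M, not necessarily on E. By `agree⇒∼′` its class in G/N′ depends only on
      -- y, so the choices are compatible with composition there.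
      extension : Automorphism E → G[Q]
      extension y = proj₁ (agrees-with-Galois em closure {M = M} M-stable (proj₂ restrictionClasses) M⊆E y)

      extension-agrees : ∀ (y : Automorphism E) {a} (a∈M : a ∈ Member M) →
                         proj₁ (to y (a , M⊆E a∈M)) ≈ extension y ⟪ a ⟫
      extension-agrees y = proj₂ (agrees-with-Galois em closure {M = M} M-stable (proj₂ restrictionClasses) M⊆E y)

      factorsThrough : FactorsThrough isGroup φ′ E
      factorsThrough = (λ y → ⟦ extension y ⟧) , isHomomorphism′ , λ σ →
        restrict {E = E} E-stable σ , (λ _ → refl) ,
        K′.member (agree⇒∼′ {σ} {extension (restrict {E = E} E-stable σ)}
          (extension-agrees (restrict {E = E} E-stable σ)))
        where
        extension-compose : ∀ y z → AgreeOn M (extension (compose y z)) (compose (extension y) (extension z))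
        extension-compose y z {a} a∈M = trans (sym (extension-agrees (compose y z) a∈M))
          (trans (Automorphism.⟦⟧-cong y {to z (a , M⊆E a∈M)}
                   {extension z ⟪ a ⟫ , M⊆E (M-stable (extension z) a∈M)} (extension-agrees z a∈M))
            (extension-agrees y (M-stable (extension z) a∈M)))

        isHomomorphism′ : IsMagmaHomomorphism (Gal E) (quotient isGroup N′) (λ y → ⟦ extension y ⟧)
        isHomomorphism′ = record
          { isRelHomomorphism = record
            { cong = λ {y} {z} y≈z → K′.member (agree⇒∼′ {extension y} {extension z} λ {a} a∈M →
                trans (sym (extension-agrees y a∈M)) (trans (y≈z (a , M⊆E a∈M)) (extension-agrees z a∈M))) }
          ; homo = λ y z → K′.member (K′.∼-trans
              (agree⇒∼′ {extension (compose y z)} {compose (extension y) (extension z)} (extension-compose y z))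
              (K′.⟦⟧-homo (extension y) (extension z)))
          }

  -- Comparison of the two maxima

  enlarge : ∀ {p} {E : IntermediateField p} {b} → BValue isGroup ef d E b →
    ∃ λ b′ → b ≤ b′ × (∀ {F : IntermediateField (c ⊔ c′ ⊔ ℓ₁′)} → IsStable (Member F) →
      Member Q⟨μ d ⟩ ⊆ Member F → BValue isGroup ef d F b′)
  enlarge (N , N⊴G , (v , N-exp , G-exp) , φ , _ , f , f-injective , _) =
    proj₁ b′ ,
    proj₂ (proj₂ b′) (S-min-mono isGroup ef N⊆N′ N-exp N′-exp ∘ f)
      (λ {i} {j} (x , k , x∈FP , eq) → f-injective (x , k , fibreProduct-φ′⇒φ {x} {k} x∈FP , eq)) ,
    λ F-stable Qμ⊆F → N′ , N′⊴G , (v , N′-exp , G-exp) , φ′ ,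
      factorsThrough F-stable (λ a∈M → Qμ⊆F (proj₂ a∈M)) , proj₁ (proj₂ b′)
    where
    open Enlarge N⊴G φ
    N′-exp = isExpOf-superset isGroup ef N⊆N′ N-exp G-exp
    b′ = b-exists N′⊴G φ′ N′-exp G-exp

  trivialSurjection : ContinuousSurjection isGroup G
  trivialSurjection = record
    { ⟦_⟧            = const (Perm.id , G.id∈)
    ; isHomomorphism = record
      { isRelHomomorphism = record { cong = λ _ → G.id∈ }
      ; homo              = λ _ _ → G.id∈
      }
    ; surjective     = λ (x , x∈G) → identity , λ _ → x∈G
    ; continuous     = λ _ → [] , λ _ _ → G.id∈
    }

  -- A first value, from N = G, so that a maximum exists; `enlarge-Value` moves it from `wholeField`
  -- to Q(μ_d).
  trivial-BValue : ∀ {v} → IsExpOf ef G v → ∃ (BValue isGroup ef d wholeField)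
  trivial-BValue {v} G-exp = proj₁ b , G , improper isGroup ef , (v , G-exp , G-exp) , trivialSurjection ,
    (const (Perm.id , G.id∈) ,
     record { isRelHomomorphism = record { cong = λ _ → G.id∈ } ; homo = λ _ _ → G.id∈ } ,
     λ σ → σ , (λ _ → refl) , G.id∈) ,
    proj₁ (proj₂ b)
    where b = b-exists (improper isGroup ef) trivialSurjection G-exp G-exp

  BValue-bounded : ∀ {p} {E : IntermediateField p} j → BValue isGroup ef d E j → j ≤ order
  BValue-bounded j (N , N⊴G , _ , φ , _ , isB) = b-bounded N⊴G φ isB

  Value : Pred ℕ _
  Value = BValue isGroup ef d Q⟨μ d ⟩

  -- `enlarge` produces b′ before the field F is chosen, so the same number is a value over both
  -- Q(μ_d) and Q(μ_∞).
  enlarge-Value : ∀ {p} {E : IntermediateField p} {k} → BValue isGroup ef d E k →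
                  ∃ λ k′ → k ≤ k′ × Value k′ × BValue isGroup ef d Q⟨μ∞⟩ k′
  enlarge-Value k-value = proj₁ enlarged , proj₁ (proj₂ enlarged) ,
    proj₂ (proj₂ enlarged) {Q⟨μ d ⟩} (Q⟨μ⟩-stable d) (λ a∈Qμ → a∈Qμ) ,
    proj₂ (proj₂ enlarged) {Q⟨μ∞⟩} Q⟨μ∞⟩-stable (Q⟨μ⟩⊆Q⟨μ∞⟩ (lcm-positive isGroup ef em |G| d-lcm))
    where enlarged = enlarge k-value

  maximal-Value : ∀ {v} → IsExpOf ef G v → ∃ (IsMaximum Value)
  maximal-Value G-exp = from (enlarge-Value (proj₂ (trivial-BValue G-exp)))
    where
    from : (∃ λ k′ → _ ≤ k′ × Value k′ × BValue isGroup ef d Q⟨μ∞⟩ k′) → ∃ (IsMaximum Value)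
    from (k , _ , k-value , _) = maximum em {P = Value} {k} k-value order BValue-bounded

  -- Enlarging b gives some k ≥ b that is a value over both fields; maximality over Q(μ_d) forces k
  -- = b. The same enlargement bounds every value over Q(μ_∞) by b.
  maximum-over-μ∞ : ∀ {b} → IsMaximum Value b → IsTürkelliConstant isGroup ef d b
  maximum-over-μ∞ {b} (b-value , b-bound) =
    attained (enlarge-Value b-value) , λ k k-value → bound (enlarge-Value k-value)
    where
    attained : (∃ λ k′ → b ≤ k′ × Value k′ × BValue isGroup ef d Q⟨μ∞⟩ k′) → BValue isGroup ef d Q⟨μ∞⟩ b
    attained (k , b≤k , k-value , k-value∞) =
      ≡.subst (BValue isGroup ef d Q⟨μ∞⟩) (ℕ.≤-antisym (b-bound k k-value) b≤k) k-value∞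

    bound : ∀ {k} → (∃ λ k′ → k ≤ k′ × Value k′ × BValue isGroup ef d Q⟨μ∞⟩ k′) → k ≤ b
    bound (k′ , k≤k′ , k′-value , _) = ℕ.≤-trans k≤k′ (b-bound k′ k′-value)

  equal-maxima : ∀ {v} → IsExpOf ef G v → ∃ λ b → IsTürkelliConstant isGroup ef d b × IsMaximum Value b
  equal-maxima G-exp = proj₁ (maximal-Value G-exp) ,
    maximum-over-μ∞ (proj₂ (maximal-Value G-exp)) , proj₂ (maximal-Value G-exp)

theorem2p16 : (∀ {ℓ} → ExcludedMiddle ℓ) →
    ∀ {n} (G : Pred (Permutation′ n) 0ℓ) (isGroup : IsPermutationGroup G) → IsTransitive G →
    (inv : ExponentFunction G) →
    ∀ {c ℓ₁ ℓ₂} (Q : HeytingField c ℓ₁ ℓ₂) → IsGlobalField Q →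
    ∀ {c′ ℓ₁′ ℓ₂′} (Ω : HeytingField c′ ℓ₁′ ℓ₂′)
    (ι : HeytingField.Carrier Q → HeytingField.Carrier Ω)
    (isHom : IsRingHomomorphism (FieldTheory.rawRing Q) (FieldTheory.rawRing Ω) ι) →
    (let open Galois {Q = Q} {Ω = Ω} isHom) →
    IsSeparableClosure →
    (order : ℕ) → GroupOrder G order →
    (∀ p → Prime p → HasCharacteristic Q p → gcd order p ≡ 1) →
    (exp[G] : ℕ) → IsExpOf inv G exp[G] →
    (d : ℕ) → IsLCM (MinimalOrder inv) d →
    ∃ λ b → IsTürkelliConstant isGroup inv d b × IsMaximum (BValue isGroup inv d Q⟨μ d ⟩) b
theorem2p16 em G isGroup _ inv Q _ Ω ι isHom closure order |G| _ exp[G] G-exp d d-lcm =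
  MaximalValue.equal-maxima em isHom closure isGroup |G| inv d-lcm G-exp
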